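{- Consider, for step sets $X\subseteq\mathbb{Z}^2\setminus\{O\}$ and submonoids $\mathcal{C}$ of $\mathbb{Z}^2$, the following seven implications: (1) $X$ satisfies CC $\Rightarrow$ $X$ satisfies SLC; (2) $X$ satisfies SLC $\Rightarrow$ $X$ satisfies LC; (3) $(X,\mathcal{C})$ has the FPP $\Rightarrow$ $(X,\mathcal{C})$ has the BPP; (4) $(X,\mathcal{C})$ has the BPP $\Rightarrow$ $(X,\mathcal{C})$ does not have the IPP; (5) $X$ satisfies CC $\Rightarrow$ $(X,\mathcal{C})$ has the FPP; (6) $X$ satisfies SLC $\Rightarrow$ $(X,\mathcal{C})$ has the BPP; (7) $X$ satisfies LC $\Rightarrow$ $(X,\mathcal{C})$ does not have the IPP. Then: (i) All of (1)–(7) hold for an arbitrary step set $X\subseteq\mathbb{Z}^2\setminus\{O\}$ and an arbitrary submonoid $\mathcal{C}$ of $\mathbb{Z}^2$. (ii) For finite $X$ (and an arbitrary submonoid $\mathcal{C}$ of $\mathbb{Z}^2$), the implications (1), (2) and (3) are reversible, i.e. their converses also hold; whereas (4), (5), (6) and (7) are not reversible in general, i.e. for each of these four there is a pair $(X,\mathcal{C})$, with $X$ a finite step set and $\mathcal{C}$ a submonoid of $\mathbb{Z}^2$, for which the converse fails. (iii) In general (for arbitrary, possibly infinite, step sets $X$), none of (1)–(7) is reversible, i.e. for each of them there is a pair $(X,\mathcal{C})$, with $X$ a step set and $\mathcal{C}$ a submonoid of $\mathbb{Z}^2$, for which the converse fails.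
   Context: Write $O=(0,0)$. A step set is any (finite or infinite) subset $X$ of $\mathbb{Z}^2\setminus\{O\}$. $\mathcal{F}_X$ is the free monoid on $X$ (all finite words over $X$, including the empty word), with $\ell(w)$ the length of $w$; for $w=A_1\cdots A_k\in\mathcal{F}_X$ put $\alpha_X(w)=A_1+\cdots+A_k\in\mathbb{Z}^2$ and, for $0\le m\le k$, $\sigma_m(w)=A_1\cdots A_m$ (initial subword). For $\mathcal{C}\subseteq\mathbb{Z}^2$ with $O\in\mathcal{C}$, define $$\mathcal{F}_X^{\mathcal{C}}=\{w\in\mathcal{F}_X:\alpha_X(\sigma_m(w))\in\mathcal{C}\text{ for all }0\le m\le\ell(w)\},\qquad \mathcal{A}_X^{\mathcal{C}}=\alpha_X(\mathcal{F}_X^{\mathcal{C}}),$$ and for $A\in\mathbb{Z}^2$ let $\Pi_X^{\mathcal{C}}(A)=\{w\in\mathcal{F}_X^{\mathcal{C}}:\alpha_X(w)=A\}$ and $\pi_X^{\mathcal{C}}(A)=|\Pi_X^{\mathcal{C}}(A)|$. $(X,\mathcal{C})$ has the FPP if $\pi_X^{\mathcal{C}}(A)<\infty$ for all $A\in\mathcal{A}_X^{\mathcal{C}}$; the IPP if $\pi_X^{\mathcal{C}}(A)=\infty$ for all $A\in\mathcal{A}_X^{\mathcal{C}}$; the BPP if for every $A\in\mathcal{A}_X^{\mathcal{C}}$ the set $\{\ell(w):w\in\Pi_X^{\mathcal{C}}(A)\}$ is finite. A line splits $\mathbb{R}^2$ into two open half-planes, which are opposites of each other. A cone is an intersection of two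 open half-planes whose bounding lines are not parallel; its vertex is the intersection point of these lines. $X$ satisfies the LC (Line Condition) if it is contained in an open half-plane bounded by a line through $O$; the SLC (Strong Line Condition) if it is contained in an open half-plane whose opposite open half-plane contains $O$; the CC (Cone Condition) if it is contained in a cone with vertex $O$. -}

module Defs where

open import Level using (0ℓ)
open import Data.Nat.Base as ℕ using (ℕ)
import Data.Nat.Properties as ℕ
open import Data.Integer.Base as ℤ using (ℤ; 0ℤ)
open import Data.Rational.Base as ℚ using (ℚ; 0ℚ; 1ℚ; ½)
import Data.Rational.Properties as ℚ
open import Data.List.Base using (List; foldr; length; take)
open import Data.List.Membership.Propositional using () renaming (_∈_ to _∈ₗ_)
open import Data.List.Relation.Unary.All using (All)
open import Data.Product.Base using (_×_; _,_; ∃; ∃-syntax)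
open import Data.Sign.Base using (Sign; opposite)
open import Data.Sum.Base using (_⊎_)
open import Relation.Nullary.Decidable.Core using (dec⇒maybe)
open import Relation.Nullary.Negation.Core using (¬_)
open import Relation.Unary using (Pred; _∈_; _∉_; _⊆_; _≐_; _∩_)
open import Relation.Binary.PropositionalEquality using (_≡_; sym; trans; cong; subst)
open import Tactic.RingSolver using (solve-∀)
open import Tactic.RingSolver.Core.AlmostCommutativeRing
  using (AlmostCommutativeRing; fromCommutativeRing)

------------------------------------------------------------------------
-- Real numbers: Cauchy sequences of rationals

Eventually : Pred ℕ 0ℓ → Set
Eventually P = ∃[ N ] ∀ n → N ℕ.≤ n → P n

Cauchy : (ℕ → ℚ) → Set
Cauchy s = ∀ ε → 0ℚ ℚ.< ε →
  ∃[ N ] ∀ m n → N ℕ.≤ m → N ℕ.≤ n → ℚ.∣ s m ℚ.- s n ∣ ℚ.< ε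

record ℝ : Set where
  constructor mkℝ
  field
    seq    : ℕ → ℚ
    cauchy : Cauchy seq

open ℝ public

infix 4 _≈_ _<_ _#_

_≈_ : ℝ → ℝ → Set
x ≈ y = ∀ ε → 0ℚ ℚ.< ε → Eventually λ n → ℚ.∣ seq x n ℚ.- seq y n ∣ ℚ.< ε

_<_ : ℝ → ℝ → Set
x < y = ∃[ ε ] (0ℚ ℚ.< ε × Eventually λ n → seq x n ℚ.+ ε ℚ.≤ seq y n)

-- Apartness, the constructive (classically equivalent) form of x ≢ y.
_#_ : ℝ → ℝ → Set
x # y = x < y ⊎ y < x

private
  ℚ-ring : AlmostCommutativeRing 0ℓ 0ℓ
  ℚ-ring = fromCommutativeRing ℚ.+-*-commutativeRing (λ q → dec⇒maybe (0ℚ ℚ.≟ q))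

  0<½* : ∀ {ε} → 0ℚ ℚ.< ε → 0ℚ ℚ.< ½ ℚ.* ε
  0<½* {ε} 0<ε = subst (ℚ._< ½ ℚ.* ε) (ℚ.*-zeroʳ ½) (ℚ.*-monoʳ-<-pos ½ 0<ε)

  half+half : ∀ ε → ½ ℚ.* ε ℚ.+ ½ ℚ.* ε ≡ ε
  half+half ε = trans (sym (ℚ.*-distribʳ-+ ε ½ ½)) (ℚ.*-identityˡ ε)

  +-difference : ∀ a b c d →
    (a ℚ.+ b) ℚ.- (c ℚ.+ d) ≡ (a ℚ.- c) ℚ.+ (b ℚ.- d)
  +-difference = solve-∀ ℚ-ring

  *-difference : ∀ a b c d →
    (a ℚ.* b) ℚ.- (c ℚ.* d) ≡ a ℚ.* (b ℚ.- d) ℚ.+ d ℚ.* (a ℚ.- c)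
  *-difference = solve-∀ ℚ-ring

  bound : ∀ {s} → Cauchy s →
    ∃[ B ] (0ℚ ℚ.< B × Eventually λ n → ℚ.∣ s n ∣ ℚ.≤ B)
  bound {s} c with c 1ℚ (ℚ.positive⁻¹ 1ℚ)
  ... | N , close = 1ℚ ℚ.+ ℚ.∣ s N ∣
                  , ℚ.+-mono-<-≤ (ℚ.positive⁻¹ 1ℚ) (ℚ.0≤∣p∣ (s N))
                  , N , λ n N≤n → begin
      ℚ.∣ s n ∣                         ≡⟨ cong ℚ.∣_∣ (split (s n) (s N)) ⟩
      ℚ.∣ (s n ℚ.- s N) ℚ.+ s N ∣       ≤⟨ ℚ.∣p+q∣≤∣p∣+∣q∣ (s n ℚ.- s N) (s N) ⟩
      ℚ.∣ s n ℚ.- s N ∣ ℚ.+ ℚ.∣ s N ∣   ≤⟨ ℚ.+-monoˡ-≤ ℚ.∣ s N ∣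
                                           (ℚ.<⇒≤ (close n N N≤n ℕ.≤-refl)) ⟩
      1ℚ ℚ.+ ℚ.∣ s N ∣                  ∎
    where
    open ℚ.≤-Reasoning
    split : ∀ p q → p ≡ (p ℚ.- q) ℚ.+ q
    split = solve-∀ ℚ-ring

  ∣*∣-bound : ∀ {B δ} p q → 0ℚ ℚ.< B → ℚ.∣ p ∣ ℚ.≤ B → ℚ.∣ q ∣ ℚ.< δ →
              ℚ.∣ p ℚ.* q ∣ ℚ.< B ℚ.* δ
  ∣*∣-bound {B} {δ} p q 0<B p≤B q<δ = begin-strict
    ℚ.∣ p ℚ.* q ∣        ≡⟨ ℚ.∣p*q∣≡∣p∣*∣q∣ p q ⟩
    ℚ.∣ p ∣ ℚ.* ℚ.∣ q ∣  ≤⟨ ℚ.*-monoʳ-≤-nonNeg ℚ.∣ q ∣ {{ℚ.nonNegative (ℚ.0≤∣p∣ q)}} p≤B ⟩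
    B ℚ.* ℚ.∣ q ∣        <⟨ ℚ.*-monoʳ-<-pos B {{ℚ.positive 0<B}} q<δ ⟩
    B ℚ.* δ              ∎
    where open ℚ.≤-Reasoning

  +-cauchy : ∀ {s t} → Cauchy s → Cauchy t → Cauchy (λ n → s n ℚ.+ t n)
  +-cauchy {s} {t} cs ct ε 0<ε with cs (½ ℚ.* ε) (0<½* 0<ε) | ct (½ ℚ.* ε) (0<½* 0<ε)
  ... | M , closeₛ | N , closeₜ = M ℕ.⊔ N , λ m n ≤m ≤n → begin-strict
      ℚ.∣ (s m ℚ.+ t m) ℚ.- (s n ℚ.+ t n) ∣
        ≡⟨ cong ℚ.∣_∣ (+-difference (s m) (t m) (s n) (t n)) ⟩
      ℚ.∣ (s m ℚ.- s n) ℚ.+ (t m ℚ.- t n) ∣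
        ≤⟨ ℚ.∣p+q∣≤∣p∣+∣q∣ (s m ℚ.- s n) (t m ℚ.- t n) ⟩
      ℚ.∣ s m ℚ.- s n ∣ ℚ.+ ℚ.∣ t m ℚ.- t n ∣
        <⟨ ℚ.+-mono-< (closeₛ m n (ℕ.m⊔n≤o⇒m≤o M N ≤m) (ℕ.m⊔n≤o⇒m≤o M N ≤n))
                      (closeₜ m n (ℕ.m⊔n≤o⇒n≤o M N ≤m) (ℕ.m⊔n≤o⇒n≤o M N ≤n)) ⟩
      ½ ℚ.* ε ℚ.+ ½ ℚ.* ε
        ≡⟨ half+half ε ⟩
      ε ∎
    where open ℚ.≤-Reasoning

  divide : ∀ D ε → 0ℚ ℚ.< D → 0ℚ ℚ.< ε → ∃[ δ ] (0ℚ ℚ.< δ × D ℚ.* δ ≡ ε)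
  divide D ε 0<D 0<ε = 1/D ℚ.* ε
    , subst (ℚ._< 1/D ℚ.* ε) (ℚ.*-zeroʳ 1/D)
        (ℚ.*-monoʳ-<-pos 1/D {{ℚ.1/pos⇒pos D {{ℚ.positive 0<D}}}} 0<ε)
    , trans (sym (ℚ.*-assoc D 1/D ε))
        (trans (cong (ℚ._* ε) (ℚ.*-inverseʳ D)) (ℚ.*-identityˡ ε))
    where
    instance
      D-nonZero : ℚ.NonZero D
      D-nonZero = ℚ.pos⇒nonZero D {{ℚ.positive 0<D}}
    1/D : ℚ
    1/D = ℚ.1/ D

  *-close : ∀ {B C δ} p q p′ q′ → 0ℚ ℚ.< B → 0ℚ ℚ.< C →
            ℚ.∣ p ∣ ℚ.≤ B → ℚ.∣ q′ ∣ ℚ.≤ C →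
            ℚ.∣ p ℚ.- p′ ∣ ℚ.< δ → ℚ.∣ q ℚ.- q′ ∣ ℚ.< δ →
            ℚ.∣ p ℚ.* q ℚ.- p′ ℚ.* q′ ∣ ℚ.< (B ℚ.+ C) ℚ.* δ
  *-close {B} {C} {δ} p q p′ q′ 0<B 0<C p≤B q′≤C p-close q-close = begin-strict
    ℚ.∣ p ℚ.* q ℚ.- p′ ℚ.* q′ ∣
      ≡⟨ cong ℚ.∣_∣ (*-difference p q p′ q′) ⟩
    ℚ.∣ p ℚ.* (q ℚ.- q′) ℚ.+ q′ ℚ.* (p ℚ.- p′) ∣
      ≤⟨ ℚ.∣p+q∣≤∣p∣+∣q∣ (p ℚ.* (q ℚ.- q′)) (q′ ℚ.* (p ℚ.- p′)) ⟩
    ℚ.∣ p ℚ.* (q ℚ.- q′) ∣ ℚ.+ ℚ.∣ q′ ℚ.* (p ℚ.- p′) ∣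
      <⟨ ℚ.+-mono-< (∣*∣-bound p (q ℚ.- q′) 0<B p≤B q-close)
                    (∣*∣-bound q′ (p ℚ.- p′) 0<C q′≤C p-close) ⟩
    B ℚ.* δ ℚ.+ C ℚ.* δ
      ≡⟨ sym (ℚ.*-distribʳ-+ δ B C) ⟩
    (B ℚ.+ C) ℚ.* δ ∎
    where open ℚ.≤-Reasoning

  *-cauchy : ∀ {s t} → Cauchy s → Cauchy t → Cauchy (λ n → s n ℚ.* t n)
  *-cauchy {s} {t} cs ct ε 0<ε =
    let B , 0<B , K , s≤B = bound {s} cs
        C , 0<C , L , t≤C = bound {t} ct
        δ , 0<δ , D*δ≡ε   = divide (B ℚ.+ C) ε (ℚ.+-mono-< 0<B 0<C) 0<ε
        M , closeₛ        = cs δ 0<δ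
        N , closeₜ        = ct δ 0<δ
    in (K ℕ.⊔ L) ℕ.⊔ (M ℕ.⊔ N) , λ m n ≤m ≤n →
      let KL≤m = ℕ.m⊔n≤o⇒m≤o (K ℕ.⊔ L) (M ℕ.⊔ N) ≤m
          KL≤n = ℕ.m⊔n≤o⇒m≤o (K ℕ.⊔ L) (M ℕ.⊔ N) ≤n
          MN≤m = ℕ.m⊔n≤o⇒n≤o (K ℕ.⊔ L) (M ℕ.⊔ N) ≤m
          MN≤n = ℕ.m⊔n≤o⇒n≤o (K ℕ.⊔ L) (M ℕ.⊔ N) ≤n
      in subst (ℚ.∣ s m ℚ.* t m ℚ.- s n ℚ.* t n ∣ ℚ.<_) D*δ≡ε
           (*-close (s m) (t m) (s n) (t n) 0<B 0<C
             (s≤B m (ℕ.m⊔n≤o⇒m≤o K L KL≤m)) (t≤C n (ℕ.m⊔n≤o⇒n≤o K L KL≤n))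
             (closeₛ m n (ℕ.m⊔n≤o⇒m≤o M N MN≤m) (ℕ.m⊔n≤o⇒m≤o M N MN≤n))
             (closeₜ m n (ℕ.m⊔n≤o⇒n≤o M N MN≤m) (ℕ.m⊔n≤o⇒n≤o M N MN≤n)))

infixl 6 _+_
infixl 7 _*_

_+_ : ℝ → ℝ → ℝ
x + y = mkℝ (λ n → seq x n ℚ.+ seq y n)
  (+-cauchy {seq x} {seq y} (cauchy x) (cauchy y))

_*_ : ℝ → ℝ → ℝ
x * y = mkℝ (λ n → seq x n ℚ.* seq y n)
  (*-cauchy {seq x} {seq y} (cauchy x) (cauchy y))

fromℚ : ℚ → ℝ
fromℚ q = mkℝ (λ _ → q) λ ε 0<ε →
  0 , λ _ _ _ _ → subst (λ r → ℚ.∣ r ∣ ℚ.< ε) (sym (ℚ.+-inverseʳ q)) 0<ε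

fromℤ : ℤ → ℝ
fromℤ i = fromℚ (i ℚ./ 1)

0ℝ : ℝ
0ℝ = fromℤ 0ℤ

------------------------------------------------------------------------
-- Lines, half-planes and cones in ℝ²

ℝ² : Set
ℝ² = ℝ × ℝ

-- The line { (x , y) ∣ a x + b y = c }.
record Line : Set where
  field
    a b c      : ℝ
    nontrivial : a # 0ℝ ⊎ b # 0ℝ

form : Line → ℝ² → ℝ
form ℓ (x , y) = a * x + b * y
  where open Line ℓ

points : Line → Pred ℝ² 0ℓ
points ℓ P = form ℓ P ≈ Line.c ℓ

-- The two sides of ℓ; halfPlane ℓ (opposite s) is the opposite of halfPlane ℓ s.
halfPlane : Line → Sign → Pred ℝ² 0ℓ
halfPlane ℓ Sign.+ P = Line.c ℓ < form ℓ P
halfPlane ℓ Sign.- P = form ℓ P < Line.c ℓ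

NonParallel : Line → Line → Set
NonParallel ℓ₁ ℓ₂ = a ℓ₁ * b ℓ₂ # a ℓ₂ * b ℓ₁
  where open Line

record Cone : Set where
  field
    line₁ line₂ : Line
    side₁ side₂ : Sign
    nonParallel : NonParallel line₁ line₂

  region : Pred ℝ² 0ℓ
  region = halfPlane line₁ side₁ ∩ halfPlane line₂ side₂

  IsVertex : Pred ℝ² 0ℓ
  IsVertex = points line₁ ∩ points line₂

------------------------------------------------------------------------
-- The lattice ℤ²

ℤ² : Set
ℤ² = ℤ × ℤ

O : ℤ²
O = 0ℤ , 0ℤ

infixl 6 _⊕_

_⊕_ : ℤ² → ℤ² → ℤ²
(x , y) ⊕ (x′ , y′) = x ℤ.+ x′ , y ℤ.+ y′

ι : ℤ² → ℝ²
ι (x , y) = fromℤ x , fromℤ y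

record StepSet : Set₁ where
  field
    steps : Pred ℤ² 0ℓ
    O∉    : O ∉ steps

open StepSet public

record Submonoid : Set₁ where
  field
    carrier  : Pred ℤ² 0ℓ
    O∈       : O ∈ carrier
    ⊕-closed : ∀ {A B} → A ∈ carrier → B ∈ carrier → A ⊕ B ∈ carrier

open Submonoid public

-- All elements of P occur in some list.  Since P need not be decidable, no
-- exact list is demanded; classically a subset of a finite set is finite, so
-- both requirements agree.
Finite : {A : Set} → Pred A 0ℓ → Set
Finite P = ∃[ xs ] P ⊆ (_∈ₗ xs)

-- A finite step set is presented by an exact list of its elements.
FiniteStepSet : StepSet → Set
FiniteStepSet X = ∃[ xs ] steps X ≐ (_∈ₗ xs)

------------------------------------------------------------------------
-- Words and lattice paths

-- Words are lists of lattice points, those over X being singled out by All, so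
-- that proofs of membership in X do not multiply the number of words.
Word : Set
Word = List ℤ²

α : Word → ℤ²
α = foldr _⊕_ O

FreeMonoid : StepSet → Pred Word 0ℓ
FreeMonoid X = All (steps X)

-- take m w is the initial subword of w of length m.
Paths : StepSet → Submonoid → Pred Word 0ℓ
Paths X C w = w ∈ FreeMonoid X × (∀ m → m ℕ.≤ length w → α (take m w) ∈ carrier C)

Endpoints : StepSet → Submonoid → Pred ℤ² 0ℓ
Endpoints X C A = ∃[ w ] (w ∈ Paths X C × α w ≡ A)

PathsTo : StepSet → Submonoid → ℤ² → Pred Word 0ℓ
PathsTo X C A w = w ∈ Paths X C × α w ≡ A

LengthsTo : StepSet → Submonoid → ℤ² → Pred ℕ 0ℓ
LengthsTo X C A n = ∃[ w ] (w ∈ PathsTo X C A × length w ≡ n)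

FPP : StepSet → Submonoid → Set
FPP X C = ∀ A → A ∈ Endpoints X C → Finite (PathsTo X C A)

IPP : StepSet → Submonoid → Set
IPP X C = ∀ A → A ∈ Endpoints X C → ¬ Finite (PathsTo X C A)

BPP : StepSet → Submonoid → Set
BPP X C = ∀ A → A ∈ Endpoints X C → Finite (LengthsTo X C A)

------------------------------------------------------------------------
-- Geometric conditions on step sets

_LiesIn_ : StepSet → Pred ℝ² 0ℓ → Set
X LiesIn R = ∀ {A} → A ∈ steps X → ι A ∈ R

LC : StepSet → Set
LC X = ∃[ ℓ ] ∃[ s ] (ι O ∈ points ℓ × X LiesIn halfPlane ℓ s)

SLC : StepSet → Set
SLC X = ∃[ ℓ ] ∃[ s ] (X LiesIn halfPlane ℓ s × ι O ∈ halfPlane ℓ (opposite s))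

CC : StepSet → Set
CC X = ∃[ K ] (ι O ∈ Cone.IsVertex K × X LiesIn Cone.region K)

{-# OPTIONS --safe #-}

-- Everything rests on one rational condition: X is coercive if some rational
-- functional f satisfies f ≥ κ (∣x∣ + ∣y∣) on X for a rational κ > 0.  It is
-- equivalent to CC: the sum of the two functionals bounding a cone is coercive by
-- Cramer's rule, and remains so after a small rational perturbation; conversely a
-- coercive functional can be tilted both ways.  Coercivity bounds both the number
-- and the size of the steps of a word with given endpoint, whence the FPP, and
-- since ∣x∣ + ∣y∣ ≥ 1 on X it also yields the SLC.  Under the SLC f ≥ δ > 0 on X,
-- so lengths are bounded by f(A) / δ.  Under the LC every nonempty word has
-- f(α w) > 0, so only the empty word returns to O; if X is finite, then f may be
-- taken rational and is automatically coercive.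
--
-- Counterexamples: {(±1, 0)} with the trivial submonoid, whose only path is empty;
-- {(±1, 0), (0, 1)} with {O} ∪ {y > 0}, where O has one path but (0, 1) has paths
-- of unbounded length; the column {(1, k)}, which has infinitely many paths to
-- (2, 0) of length 2; and the vectors vₖ with vₖ₊₂ = vₖ − vₖ₊₁, all on one side of
-- a line of golden slope, where v₀ = v₁ + v₂ = v₁ + v₃ + v₄ = … has words of
-- unbounded length, so that the BPP and hence the SLC fail.
module Submission where

open import Defs
open import Level using (0ℓ)
open import Data.Integer.Base as ℤ using (ℤ; 0ℤ; 1ℤ; -1ℤ; +_; -[1+_])
import Data.Integer.Properties as ℤ
import Data.Integer.Tactic.RingSolver as ℤ-Ring
open import Data.List.Base
  using ( List; []; _∷_; [_]; _++_; map; length; take; foldr; concat; replicate; upTo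
        ; cartesianProduct; cartesianProductWith)
open import Data.List.Extrema.Nat using (max; xs≤max)
open import Data.List.Membership.Propositional using () renaming (_∈_ to _∈ₗ_)
open import Data.List.Membership.Propositional.Properties
  using (∈-map⁺; ∈-upTo⁺; ∈-++⁺ˡ; ∈-++⁺ʳ; ∈-cartesianProduct⁺; ∈-cartesianProductWith⁺)
import Data.List.Properties as List
open import Data.List.Relation.Unary.All as All using (All; []; _∷_)
import Data.List.Relation.Unary.All.Properties as All
open import Data.List.Relation.Unary.Any using (here; there)
open import Data.Nat.Base as ℕ using (ℕ; zero; suc; z≤n; s≤s)
import Data.Nat.Coprimality as Coprimality
import Data.Nat.Properties as ℕ
open import Data.Product.Base using (_×_; _,_; ∃; ∃₂; ∃-syntax; proj₁; proj₂)
open import Data.Rational.Base as ℚ using (ℚ; mkℚ; 0ℚ; 1ℚ; ½; *≤*; *<*; ↥_; ↧_; ↧ₙ_)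
import Data.Rational.Properties as ℚ
import Data.Rational.Unnormalised.Base as ℚᵘ
import Data.Rational.Unnormalised.Properties as ℚᵘ
open import Data.Sign.Base using (Sign; opposite)
open import Data.Sum.Base as Sum using (_⊎_; inj₁; inj₂)
open import Data.Unit.Base using (⊤)
open import Function.Base using (_∘_; id)
open import Relation.Binary.Definitions using (tri<; tri≈; tri>)
open import Relation.Binary.PropositionalEquality
  using (_≡_; _≢_; refl; sym; trans; cong; cong₂; subst; subst₂; module ≡-Reasoning)
open import Relation.Nullary.Decidable.Core using (yes; no; dec⇒maybe)
open import Relation.Nullary.Negation.Core using (¬_; contradiction)
open import Relation.Unary using (Pred; _∈_)
open import Tactic.RingSolver using (solve-∀)
open import Tactic.RingSolver.Core.AlmostCommutativeRing
  using (AlmostCommutativeRing; fromCommutativeRing)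

-- Words and paths

finite-bounded : {A : Set} {P : Pred A 0ℓ} (f : A → ℕ) → Finite P →
                 ∃[ B ] (∀ {a} → a ∈ P → f a ℕ.≤ B)
finite-bounded f (xs , P⊆xs) =
  max 0 (map f xs) , λ a∈P → All.lookup (xs≤max 0 (map f xs)) (∈-map⁺ f (P⊆xs a∈P))

-- Infinite sets are recognised by an unbounded statistic `f`: the length in arguments about the
-- BPP, the total size of the steps where all words are equally long.
unbounded⇒¬finite : {A : Set} {P : Pred A 0ℓ} (f : A → ℕ) →
                    (∀ n → ∃[ a ] (a ∈ P × n ℕ.≤ f a)) → ¬ Finite P
unbounded⇒¬finite f unbounded fin =
  let B , bounded   = finite-bounded f fin
      a , a∈P , B<a = unbounded (suc B)
  in ℕ.<⇒≱ B<a (bounded a∈P)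

wordsUpTo : {A : Set} → List A → ℕ → List (List A)
wordsUpTo xs zero    = [ [] ]
wordsUpTo xs (suc n) = [] ∷ cartesianProductWith _∷_ xs (wordsUpTo xs n)

∈-wordsUpTo : {A : Set} {xs : List A} {n : ℕ} {w : List A} →
              All (_∈ₗ xs) w → length w ℕ.≤ n → w ∈ₗ wordsUpTo xs n
∈-wordsUpTo {n = zero}  []         _           = here refl
∈-wordsUpTo {n = suc n} []         _           = here refl
∈-wordsUpTo {n = suc n} (a∈ ∷ all) (s≤s len≤n) =
  there (∈-cartesianProductWith⁺ _∷_ a∈ (∈-wordsUpTo all len≤n))

⊕-assoc : ∀ A B D → (A ⊕ B) ⊕ D ≡ A ⊕ (B ⊕ D)
⊕-assoc (x , y) (x′ , y′) (x″ , y″) = cong₂ _,_ (ℤ.+-assoc x x′ x″) (ℤ.+-assoc y y′ y″)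

⊕-identityˡ : ∀ A → O ⊕ A ≡ A
⊕-identityˡ (x , y) = cong₂ _,_ (ℤ.+-identityˡ x) (ℤ.+-identityˡ y)

⊕-identityʳ : ∀ A → A ⊕ O ≡ A
⊕-identityʳ (x , y) = cong₂ _,_ (ℤ.+-identityʳ x) (ℤ.+-identityʳ y)

α-++ : ∀ v w → α (v ++ w) ≡ α v ⊕ α w
α-++ []      w = sym (⊕-identityˡ (α w))
α-++ (A ∷ v) w = trans (cong (A ⊕_) (α-++ v w)) (sym (⊕-assoc A (α v) (α w)))

module _ (X : StepSet) (C : Submonoid) where

  prefix∈ : ∀ {w} → w ∈ Paths X C → ∀ m → α (take m w) ∈ carrier C
  prefix∈ {w} (_ , inside) m with m ℕ.≤? length w
  ... | yes m≤l = inside m m≤l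
  ... | no  m≰l = subst (λ v → α v ∈ carrier C)
                    (trans (List.take-all (length w) w ℕ.≤-refl)
                      (sym (List.take-all m w (ℕ.≰⇒≥ m≰l))))
                    (inside (length w) ℕ.≤-refl)

  α∈ : ∀ {w} → w ∈ Paths X C → α w ∈ carrier C
  α∈ {w} p = subst (λ v → α v ∈ carrier C)
               (List.take-all (length w) w ℕ.≤-refl) (prefix∈ p (length w))

  []∈Paths : [] ∈ Paths X C
  []∈Paths = [] , λ { zero _ → O∈ C ; (suc _) _ → O∈ C }

  O∈Endpoints : O ∈ Endpoints X C
  O∈Endpoints = [] , []∈Paths , refl

  -- A prefix reaching past `v` ends at `α v` plus the endpoint of a prefix of `w`; here closure of
  -- `C` under addition enters.
  prefix-++ : ∀ v w → (∀ m → α (take m v) ∈ carrier C) → α v ∈ carrier C →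
              (∀ m → α (take m w) ∈ carrier C) → ∀ m → α (take m (v ++ w)) ∈ carrier C
  prefix-++ v w v∈ αv∈ w∈ m with m ℕ.≤? length v
  ... | yes m≤l = subst (λ u → α u ∈ carrier C) (sym (take-++-≤ m v m≤l)) (v∈ m)
    where
    take-++-≤ : ∀ m v → m ℕ.≤ length v → take m (v ++ w) ≡ take m v
    take-++-≤ zero    v       _         = refl
    take-++-≤ (suc m) (A ∷ v) (s≤s m≤l) = cong (A ∷_) (take-++-≤ m v m≤l)
  ... | no  m≰l = subst (_∈ carrier C)
      (trans (sym (α-++ v (take (m ℕ.∸ length v) w)))
             (cong α (sym (take-++-≥ m v (ℕ.≰⇒≥ m≰l)))))
      (⊕-closed C αv∈ (w∈ (m ℕ.∸ length v)))
    where
    take-++-≥ : ∀ m v → length v ℕ.≤ m → take m (v ++ w) ≡ v ++ take (m ℕ.∸ length v) w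
    take-++-≥ m       []      _         = refl
    take-++-≥ (suc m) (A ∷ v) (s≤s l≤m) = cong (A ∷_) (take-++-≥ m v l≤m)

  ++-Paths : ∀ {v w} → v ∈ Paths X C → w ∈ Paths X C → v ++ w ∈ Paths X C
  ++-Paths {v} {w} p q =
    All.++⁺ (proj₁ p) (proj₁ q) ,
    λ m _ → prefix-++ v w (prefix∈ p) (α∈ p) (prefix∈ q) m

  ++-loops : ∀ {v w} → v ∈ PathsTo X C O → w ∈ PathsTo X C O → v ++ w ∈ PathsTo X C O
  ++-loops {v} {w} (p , αv≡O) (q , αw≡O) =
    ++-Paths p q , trans (α-++ v w) (cong₂ _⊕_ αv≡O αw≡O)

  power-loop : ∀ {w} k → w ∈ PathsTo X C O → concat (replicate k w) ∈ PathsTo X C O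
  power-loop zero    _ = []∈Paths , refl
  power-loop (suc k) p = ++-loops p (power-loop k p)

  FPP⇒BPP : FPP X C → BPP X C
  FPP⇒BPP fpp A A∈ =
    let ws , ⊆ws = fpp A A∈
    in map length ws , λ { (_ , w∈ , refl) → ∈-map⁺ length (⊆ws w∈) }

  no-loops⇒¬IPP : (∀ {w} → w ∈ PathsTo X C O → w ≡ []) → ¬ IPP X C
  no-loops⇒¬IPP no-loop ipp = ipp O O∈Endpoints ([ [] ] , here ∘ no-loop)

  -- A nonempty loop at O could be traversed any number of times, giving paths to O of unbounded
  -- length. So the empty path is the only one to O.
  BPP⇒¬IPP : BPP X C → ¬ IPP X C
  BPP⇒¬IPP bpp = no-loops⇒¬IPP no-loop
    where
    no-loop : ∀ {w} → w ∈ PathsTo X C O → w ≡ []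
    no-loop {[]}    _ = refl
    no-loop {A ∷ v} p = contradiction (bpp O O∈Endpoints)
      (unbounded⇒¬finite id λ n → _ , (_ , power-loop n p , refl) , long n)
      where
      long : ∀ n → n ℕ.≤ length (concat (replicate n (A ∷ v)))
      long zero    = z≤n
      long (suc n) = s≤s (ℕ.≤-trans (long n)
        (ℕ.≤-trans (ℕ.m≤n+m _ (length v)) (ℕ.≤-reflexive (sym (List.length-++ v)))))

  bounded⇒BPP : (∀ A → ∃[ B ] (∀ {w} → w ∈ FreeMonoid X → α w ≡ A → length w ℕ.≤ B)) → BPP X C
  bounded⇒BPP bounded A _ =
    let B , len≤B = bounded A
    in upTo (suc B) , λ { (_ , ((w∈ , _) , αw≡A) , refl) → ∈-upTo⁺ (s≤s (len≤B w∈ αw≡A)) }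

  unbounded⇒¬BPP : ∀ A → (∀ n → ∃[ w ] (w ∈ PathsTo X C A × n ℕ.≤ length w)) → ¬ BPP X C
  unbounded⇒¬BPP A unbounded bpp =
    let w , (w∈ , αw≡A) , _ = unbounded 0
    in contradiction (bpp A (w , w∈ , αw≡A)) (unbounded⇒¬finite id λ n →
         let v , v∈ , n≤l = unbounded n in length v , (v , v∈ , refl) , n≤l)

  -- A finite alphabet has only finitely many words of bounded length.
  finite∧BPP⇒FPP : FiniteStepSet X → BPP X C → FPP X C
  finite∧BPP⇒FPP (xs , X⊆xs , _) bpp A A∈ =
    let B , len≤B = finite-bounded id (bpp A A∈)
    in wordsUpTo xs B , λ { {w} p@((w∈ , _) , _) →
         ∈-wordsUpTo (All.map X⊆xs w∈) (len≤B (w , p , refl)) }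

-- Rational arithmetic

ℚ-ring : AlmostCommutativeRing 0ℓ 0ℓ
ℚ-ring = fromCommutativeRing ℚ.+-*-commutativeRing (λ q → dec⇒maybe (0ℚ ℚ.≟ q))

⟦_⟧ : ℤ → ℚ
⟦ i ⟧ = i ℚ./ 1

-- ⟦ i ⟧ normalises by a gcd and is stuck for open i, unlike integral i.
private
  integral : ℤ → ℚ
  integral i = mkℚ i 0 (Coprimality.sym (Coprimality.1-coprimeTo ℤ.∣ i ∣))

  ⟦⟧≡integral : ∀ i → ⟦ i ⟧ ≡ integral i
  ⟦⟧≡integral i = ℚ.↥p/↧p≡p (integral i)

⟦⟧-+ : ∀ i j → ⟦ i ℤ.+ j ⟧ ≡ ⟦ i ⟧ ℚ.+ ⟦ j ⟧
⟦⟧-+ i j = sym (trans (cong₂ ℚ._+_ (⟦⟧≡integral i) (⟦⟧≡integral j))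
  (cong (ℚ._/ 1) (cong₂ ℤ._+_ (ℤ.*-identityʳ i) (ℤ.*-identityʳ j))))

⟦⟧-* : ∀ i j → ⟦ i ℤ.* j ⟧ ≡ ⟦ i ⟧ ℚ.* ⟦ j ⟧
⟦⟧-* i j = sym (cong₂ ℚ._*_ (⟦⟧≡integral i) (⟦⟧≡integral j))

⟦⟧-neg : ∀ i → ⟦ ℤ.- i ⟧ ≡ ℚ.- ⟦ i ⟧
⟦⟧-neg i = trans (⟦⟧≡integral (ℤ.- i)) (trans (sym (lemma i)) (cong ℚ.-_ (sym (⟦⟧≡integral i))))
  where
  lemma : ∀ i → ℚ.- integral i ≡ integral (ℤ.- i)
  lemma (+ zero)  = refl
  lemma (+ suc _) = refl
  lemma -[1+ _ ]  = refl

⟦⟧-mono-≤ : ∀ {i j} → i ℤ.≤ j → ⟦ i ⟧ ℚ.≤ ⟦ j ⟧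
⟦⟧-mono-≤ {i} {j} i≤j = subst₂ ℚ._≤_ (sym (⟦⟧≡integral i)) (sym (⟦⟧≡integral j))
  (*≤* (subst₂ ℤ._≤_ (sym (ℤ.*-identityʳ i)) (sym (ℤ.*-identityʳ j)) i≤j))

⟦⟧-cancel-≤ : ∀ {i j} → ⟦ i ⟧ ℚ.≤ ⟦ j ⟧ → i ℤ.≤ j
⟦⟧-cancel-≤ {i} {j} p = subst₂ ℤ._≤_ (ℤ.*-identityʳ i) (ℤ.*-identityʳ j)
  (ℚ.drop-*≤* (subst₂ ℚ._≤_ (⟦⟧≡integral i) (⟦⟧≡integral j) p))

0≤⟦+⟧ : ∀ n → 0ℚ ℚ.≤ ⟦ + n ⟧
0≤⟦+⟧ n = ⟦⟧-mono-≤ {0ℤ} {+ n} (ℤ.+≤+ z≤n)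

1≤⟦+⟧ : ∀ {n} → 1 ℕ.≤ n → 1ℚ ℚ.≤ ⟦ + n ⟧
1≤⟦+⟧ {n} 1≤n = ⟦⟧-mono-≤ {1ℤ} {+ n} (ℤ.+≤+ 1≤n)

∣⟦⟧∣ : ∀ i → ℚ.∣ ⟦ i ⟧ ∣ ≡ ⟦ + ℤ.∣ i ∣ ⟧
∣⟦⟧∣ i = trans (cong ℚ.∣_∣ (⟦⟧≡integral i)) (sym (⟦⟧≡integral (+ ℤ.∣ i ∣)))

*-denominator : ∀ p → p ℚ.* ⟦ ↧ p ⟧ ≡ ⟦ ↥ p ⟧
*-denominator p@record{} = trans (cong (p ℚ.*_) (⟦⟧≡integral (↧ p))) (trans
  (ℚ.toℚᵘ-injective (ℚᵘ.≃-trans (ℚ.toℚᵘ-homo-* p (integral (↧ p)))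
    (ℚᵘ.*≡* (ℤ.*-assoc (↥ p) (↧ p) 1ℤ))))
  (sym (⟦⟧≡integral (↥ p))))

*-monoˡ-≤ : ∀ {r p q} → 0ℚ ℚ.≤ r → p ℚ.≤ q → r ℚ.* p ℚ.≤ r ℚ.* q
*-monoˡ-≤ {r} 0≤r = ℚ.*-monoˡ-≤-nonNeg r {{ℚ.nonNegative 0≤r}}

*-monoʳ-≤ : ∀ {r p q} → 0ℚ ℚ.≤ r → p ℚ.≤ q → p ℚ.* r ℚ.≤ q ℚ.* r
*-monoʳ-≤ {r} 0≤r = ℚ.*-monoʳ-≤-nonNeg r {{ℚ.nonNegative 0≤r}}

*-cancelˡ-≤ : ∀ {r p q} → 0ℚ ℚ.< r → r ℚ.* p ℚ.≤ r ℚ.* q → p ℚ.≤ q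
*-cancelˡ-≤ {r} 0<r = ℚ.*-cancelˡ-≤-pos r {{ℚ.positive 0<r}}

*-pos : ∀ {p q} → 0ℚ ℚ.< p → 0ℚ ℚ.< q → 0ℚ ℚ.< p ℚ.* q
*-pos {p} {q} 0<p 0<q = ℚ.positive⁻¹ (p ℚ.* q)
  {{ℚ.pos*pos⇒pos p {{ℚ.positive 0<p}} q {{ℚ.positive 0<q}}}}

0<1ℚ : 0ℚ ℚ.< 1ℚ
0<1ℚ = ℚ.positive⁻¹ 1ℚ

<⇒0<- : ∀ {p q} → p ℚ.< q → 0ℚ ℚ.< q ℚ.- p
<⇒0<- {p} {q} p<q = subst (ℚ._< q ℚ.- p) (ℚ.+-inverseʳ p) (ℚ.+-monoˡ-< (ℚ.- p) p<q)

≤⇒0≤- : ∀ {p q} → p ℚ.≤ q → 0ℚ ℚ.≤ q ℚ.- p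
≤⇒0≤- {p} {q} p≤q = subst (ℚ._≤ q ℚ.- p) (ℚ.+-inverseʳ p) (ℚ.+-monoˡ-≤ (ℚ.- p) p≤q)

0≤-⇒≤ : ∀ {p q} → 0ℚ ℚ.≤ q ℚ.- p → p ℚ.≤ q
0≤-⇒≤ {p} {q} 0≤ = subst₂ ℚ._≤_ (ℚ.+-identityˡ p) (lemma q p) (ℚ.+-monoˡ-≤ p 0≤)
  where
  lemma : ∀ q p → (q ℚ.- p) ℚ.+ p ≡ q
  lemma = solve-∀ ℚ-ring

p≤∣p∣ : ∀ p → p ℚ.≤ ℚ.∣ p ∣
p≤∣p∣ p with ℚ.≤-total 0ℚ p
... | inj₁ 0≤p = ℚ.≤-reflexive (sym (ℚ.0≤p⇒∣p∣≡p 0≤p))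
... | inj₂ p≤0 = ℚ.≤-trans p≤0 (ℚ.0≤∣p∣ p)

-∣p∣≤p : ∀ p → ℚ.- ℚ.∣ p ∣ ℚ.≤ p
-∣p∣≤p p = subst (ℚ.- ℚ.∣ p ∣ ℚ.≤_) (neg-involutive p)
  (ℚ.neg-antimono-≤ (subst (ℚ.- p ℚ.≤_) (ℚ.∣-p∣≡∣p∣ p) (p≤∣p∣ (ℚ.- p))))
  where
  neg-involutive : ∀ p → ℚ.- (ℚ.- p) ≡ p
  neg-involutive = solve-∀ ℚ-ring

≤+ˡ : ∀ p {q} → 0ℚ ℚ.< q → p ℚ.≤ p ℚ.+ q
≤+ˡ p {q} 0<q = subst (ℚ._≤ p ℚ.+ q) (ℚ.+-identityʳ p) (ℚ.+-monoʳ-≤ p (ℚ.<⇒≤ 0<q))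

≤+ʳ : ∀ p {q} → 0ℚ ℚ.< q → p ℚ.≤ q ℚ.+ p
≤+ʳ p {q} 0<q = subst (ℚ._≤ q ℚ.+ p) (ℚ.+-identityˡ p) (ℚ.+-monoˡ-≤ p (ℚ.<⇒≤ 0<q))

divide : ∀ D ε → 0ℚ ℚ.< D → 0ℚ ℚ.< ε → ∃[ δ ] (0ℚ ℚ.< δ × D ℚ.* δ ≡ ε)
divide D ε 0<D 0<ε = 1/D ℚ.* ε , *-pos (ℚ.positive⁻¹ 1/D {{ℚ.1/pos⇒pos D {{ℚ.positive 0<D}}}}) 0<ε
  , trans (sym (ℚ.*-assoc D 1/D ε)) (trans (cong (ℚ._* ε) (ℚ.*-inverseʳ D)) (ℚ.*-identityˡ ε))
  where
  instance
    D-nonZero : ℚ.NonZero D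
    D-nonZero = ℚ.pos⇒nonZero D {{ℚ.positive 0<D}}
  1/D : ℚ
  1/D = ℚ.1/ D

-- Both sides are multiplied by the denominator of `δ`. The left side is then at least `k`, since
-- the numerator of `δ` is at least 1, and `B` is at most the absolute value of its own numerator.
archimedean : ∀ {δ} → 0ℚ ℚ.< δ → ∀ B → ∃[ N ] (∀ {k} → ⟦ + k ⟧ ℚ.* δ ℚ.≤ B → k ℕ.≤ N)
archimedean {δ} 0<δ B = ℤ.∣ ↥ B ∣ ℕ.* ↧ₙ δ , λ {k} kδ≤B → ℤ.drop‿+≤+ (⟦⟧-cancel-≤ {+ k} (begin
    ⟦ + k ⟧                                ≡⟨ ℚ.*-identityʳ ⟦ + k ⟧ ⟨
    ⟦ + k ⟧ ℚ.* 1ℚ                         ≤⟨ *-monoˡ-≤ (0≤⟦+⟧ k) 1≤↥δ ⟩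
    ⟦ + k ⟧ ℚ.* ⟦ ↥ δ ⟧                    ≡⟨ cong (⟦ + k ⟧ ℚ.*_) (*-denominator δ) ⟨
    ⟦ + k ⟧ ℚ.* (δ ℚ.* ⟦ ↧ δ ⟧)            ≡⟨ ℚ.*-assoc ⟦ + k ⟧ δ ⟦ ↧ δ ⟧ ⟨
    ⟦ + k ⟧ ℚ.* δ ℚ.* ⟦ ↧ δ ⟧              ≤⟨ *-monoʳ-≤ (0≤⟦+⟧ (↧ₙ δ)) kδ≤B ⟩
    B ℚ.* ⟦ ↧ δ ⟧                          ≤⟨ *-monoʳ-≤ (0≤⟦+⟧ (↧ₙ δ)) B≤↥B ⟩
    ⟦ + ℤ.∣ ↥ B ∣ ⟧ ℚ.* ⟦ ↧ δ ⟧            ≡⟨ ⟦⟧-* (+ ℤ.∣ ↥ B ∣) (↧ δ) ⟨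
    ⟦ + ℤ.∣ ↥ B ∣ ℤ.* ↧ δ ⟧                ≡⟨ cong ⟦_⟧ (sym (ℤ.pos-* ℤ.∣ ↥ B ∣ (↧ₙ δ))) ⟩
    ⟦ + (ℤ.∣ ↥ B ∣ ℕ.* ↧ₙ δ) ⟧             ∎))
  where
  open ℚ.≤-Reasoning
  1≤↥ : ∀ δ → 0ℚ ℚ.< δ → 1ℤ ℤ.≤ ↥ δ
  1≤↥ (mkℚ (+ suc n) _ _) _ = ℤ.+≤+ (s≤s z≤n)
  1≤↥ (mkℚ (+ zero) _ _)  (*<* (ℤ.+<+ ()))
  1≤↥ (mkℚ -[1+ n ] _ _)  (*<* ())
  1≤↥δ : 1ℚ ℚ.≤ ⟦ ↥ δ ⟧
  1≤↥δ = ⟦⟧-mono-≤ {1ℤ} {↥ δ} (1≤↥ δ 0<δ)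
  ≤∣↥∣ : ∀ B → B ℚ.≤ integral (+ ℤ.∣ ↥ B ∣)
  ≤∣↥∣ (mkℚ (+ n) d _)    = *≤* (subst₂ ℤ._≤_ (ℤ.pos-* n 1) (ℤ.pos-* n (suc d))
                              (ℤ.+≤+ (ℕ.*-monoʳ-≤ n (s≤s z≤n))))
  ≤∣↥∣ (mkℚ -[1+ n ] d _) = *≤* (subst (-[1+ n ] ℤ.* 1ℤ ℤ.≤_) (ℤ.pos-* (suc n) (suc d)) ℤ.-≤+)
  B≤↥B : B ℚ.≤ ⟦ + ℤ.∣ ↥ B ∣ ⟧
  B≤↥B = subst (B ℚ.≤_) (sym (⟦⟧≡integral (+ ℤ.∣ ↥ B ∣))) (≤∣↥∣ B)

-- The ℓ¹ norm and linear functionals on the lattice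

size : ℤ² → ℕ
size (x , y) = ℤ.∣ x ∣ ℕ.+ ℤ.∣ y ∣

norm : ℤ² → ℚ
norm (x , y) = ℚ.∣ ⟦ x ⟧ ∣ ℚ.+ ℚ.∣ ⟦ y ⟧ ∣

norm≡size : ∀ A → norm A ≡ ⟦ + size A ⟧
norm≡size (x , y) = trans (cong₂ ℚ._+_ (∣⟦⟧∣ x) (∣⟦⟧∣ y)) (sym (⟦⟧-+ (+ ℤ.∣ x ∣) (+ ℤ.∣ y ∣)))

1≤size : ∀ {A} → A ≢ O → 1 ℕ.≤ size A
1≤size {A} A≢O = ℕ.n≢0⇒n>0 λ size≡0 → A≢O (cong₂ _,_
  (ℤ.∣i∣≡0⇒i≡0 (ℕ.m+n≡0⇒m≡0 ℤ.∣ proj₁ A ∣ size≡0))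
  (ℤ.∣i∣≡0⇒i≡0 (ℕ.m+n≡0⇒n≡0 ℤ.∣ proj₁ A ∣ size≡0)))

0≤norm : ∀ A → 0ℚ ℚ.≤ norm A
0≤norm A = subst (0ℚ ℚ.≤_) (sym (norm≡size A)) (0≤⟦+⟧ (size A))

1≤norm : ∀ {A} → A ≢ O → 1ℚ ℚ.≤ norm A
1≤norm {A} A≢O = subst (1ℚ ℚ.≤_) (sym (norm≡size A)) (1≤⟦+⟧ (1≤size A≢O))

linear : ℚ → ℚ → ℤ² → ℚ
linear p q (x , y) = p ℚ.* ⟦ x ⟧ ℚ.+ q ℚ.* ⟦ y ⟧

linear-O : ∀ p q → linear p q O ≡ 0ℚ
linear-O p q = cong₂ ℚ._+_ (ℚ.*-zeroʳ p) (ℚ.*-zeroʳ q)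

linear-⊕ : ∀ p q A B → linear p q (A ⊕ B) ≡ linear p q A ℚ.+ linear p q B
linear-⊕ p q (x , y) (x′ , y′) =
  trans (cong₂ (λ r s → p ℚ.* r ℚ.+ q ℚ.* s) (⟦⟧-+ x x′) (⟦⟧-+ y y′))
        (rearrange p q ⟦ x ⟧ ⟦ x′ ⟧ ⟦ y ⟧ ⟦ y′ ⟧)
  where
  rearrange : ∀ p q x x′ y y′ →
    p ℚ.* (x ℚ.+ x′) ℚ.+ q ℚ.* (y ℚ.+ y′) ≡ (p ℚ.* x ℚ.+ q ℚ.* y) ℚ.+ (p ℚ.* x′ ℚ.+ q ℚ.* y′)
  rearrange = solve-∀ ℚ-ring

∣linear∣≤ : ∀ {p q B} A → ℚ.∣ p ∣ ℚ.≤ B → ℚ.∣ q ∣ ℚ.≤ B → ℚ.∣ linear p q A ∣ ℚ.≤ B ℚ.* norm A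
∣linear∣≤ {p} {q} {B} (x , y) p≤B q≤B = begin
  ℚ.∣ p ℚ.* ⟦ x ⟧ ℚ.+ q ℚ.* ⟦ y ⟧ ∣
    ≤⟨ ℚ.∣p+q∣≤∣p∣+∣q∣ (p ℚ.* ⟦ x ⟧) (q ℚ.* ⟦ y ⟧) ⟩
  ℚ.∣ p ℚ.* ⟦ x ⟧ ∣ ℚ.+ ℚ.∣ q ℚ.* ⟦ y ⟧ ∣
    ≡⟨ cong₂ ℚ._+_ (ℚ.∣p*q∣≡∣p∣*∣q∣ p ⟦ x ⟧) (ℚ.∣p*q∣≡∣p∣*∣q∣ q ⟦ y ⟧) ⟩
  ℚ.∣ p ∣ ℚ.* ℚ.∣ ⟦ x ⟧ ∣ ℚ.+ ℚ.∣ q ∣ ℚ.* ℚ.∣ ⟦ y ⟧ ∣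
    ≤⟨ ℚ.+-mono-≤ (*-monoʳ-≤ (ℚ.0≤∣p∣ ⟦ x ⟧) p≤B) (*-monoʳ-≤ (ℚ.0≤∣p∣ ⟦ y ⟧) q≤B) ⟩
  B ℚ.* ℚ.∣ ⟦ x ⟧ ∣ ℚ.+ B ℚ.* ℚ.∣ ⟦ y ⟧ ∣
    ≡⟨ ℚ.*-distribˡ-+ B ℚ.∣ ⟦ x ⟧ ∣ ℚ.∣ ⟦ y ⟧ ∣ ⟨
  B ℚ.* norm (x , y) ∎
  where open ℚ.≤-Reasoning

-- Half-planes

eventually-zip : {P Q : Pred ℕ 0ℓ} → Eventually P → Eventually Q → Eventually (λ n → P n × Q n)
eventually-zip (M , p) (N , q) = M ℕ.⊔ N , λ n ≤n →
  p n (ℕ.m⊔n≤o⇒m≤o M N ≤n) , q n (ℕ.m⊔n≤o⇒n≤o M N ≤n)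

eventually-map : {P Q : Pred ℕ 0ℓ} → (∀ n → P n → Q n) → Eventually P → Eventually Q
eventually-map f (N , p) = N , λ n N≤n → f n (p n N≤n)

eventually-witness : {P : Pred ℕ 0ℓ} → Eventually P → ∃ P
eventually-witness (N , p) = N , p N ℕ.≤-refl

-- Applied to the letters of a word, this allows a real functional to be replaced by one of its
-- rational approximations.
eventually-All : {A : Set} {P : A → Pred ℕ 0ℓ} {xs : List A} →
                 All (λ a → Eventually (P a)) xs → Eventually (λ n → All (λ a → P a n) xs)
eventually-All []       = 0 , λ _ _ → []
eventually-All (p ∷ ps) =
  eventually-map (λ _ (q , qs) → q ∷ qs) (eventually-zip p (eventually-All ps))

eventually-bounded : ∀ x → ∃[ B ] (0ℚ ℚ.< B × Eventually λ n → ℚ.∣ seq x n ∣ ℚ.≤ B)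
eventually-bounded x with cauchy x 1ℚ 0<1ℚ
... | N , close = 1ℚ ℚ.+ ℚ.∣ seq x N ∣ , ℚ.+-mono-<-≤ 0<1ℚ (ℚ.0≤∣p∣ (seq x N)) ,
  N , λ n N≤n → begin
    ℚ.∣ seq x n ∣                                  ≡⟨ cong ℚ.∣_∣ (split (seq x n) (seq x N)) ⟩
    ℚ.∣ (seq x n ℚ.- seq x N) ℚ.+ seq x N ∣        ≤⟨ ℚ.∣p+q∣≤∣p∣+∣q∣ (seq x n ℚ.- seq x N) (seq x N) ⟩
    ℚ.∣ seq x n ℚ.- seq x N ∣ ℚ.+ ℚ.∣ seq x N ∣
      ≤⟨ ℚ.+-monoˡ-≤ ℚ.∣ seq x N ∣ (ℚ.<⇒≤ (close n N N≤n ℕ.≤-refl)) ⟩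
    1ℚ ℚ.+ ℚ.∣ seq x N ∣                           ∎
  where
  open ℚ.≤-Reasoning
  split : ∀ p q → p ≡ (p ℚ.- q) ℚ.+ q
  split = solve-∀ ℚ-ring

fromℚ-mono-< : ∀ {p q} → p ℚ.< q → fromℚ p < fromℚ q
fromℚ-mono-< {p} {q} p<q = q ℚ.- p , <⇒0<- p<q , 0 , λ _ _ → ℚ.≤-reflexive (cancel p q)
  where
  cancel : ∀ p q → p ℚ.+ (q ℚ.- p) ≡ q
  cancel = solve-∀ ℚ-ring

fromℚ-# : ∀ {p} → p ≢ 0ℚ → fromℚ p # 0ℝ
fromℚ-# {p} p≢0 with ℚ.<-cmp p 0ℚ
... | tri< p<0 _ _ = inj₁ (fromℚ-mono-< p<0)
... | tri≈ _ p≡0 _ = contradiction p≡0 p≢0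
... | tri> _ _ 0<p = inj₂ (fromℚ-mono-< 0<p)

lineThroughO : (a b : ℝ) → a # 0ℝ ⊎ b # 0ℝ → Line
lineThroughO a b nontrivial = record { a = a ; b = b ; c = 0ℝ ; nontrivial = nontrivial }

O∈lineThroughO : ∀ a b nontrivial → ι O ∈ points (lineThroughO a b nontrivial)
O∈lineThroughO a b _ ε 0<ε = 0 , λ n _ →
  subst (λ r → ℚ.∣ r ℚ.- 0ℚ ∣ ℚ.< ε) (sym (linear-O (seq a n) (seq b n))) 0<ε

-- Multiplying the coefficients of a line by this sign turns both kinds of half-plane into lower
-- bounds, so that the estimates below treat the two sides at once.
sgn : Sign → ℚ
sgn Sign.+ = 1ℚ
sgn Sign.- = ℚ.- 1ℚ

∣sgn*∣ : ∀ s p → ℚ.∣ sgn s ℚ.* p ∣ ≡ ℚ.∣ p ∣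
∣sgn*∣ Sign.+ p = cong ℚ.∣_∣ (ℚ.*-identityˡ p)
∣sgn*∣ Sign.- p = trans (ℚ.∣p*q∣≡∣p∣*∣q∣ (ℚ.- 1ℚ) p) (ℚ.*-identityˡ ℚ.∣ p ∣)

linear-* : ∀ r p q A → linear (r ℚ.* p) (r ℚ.* q) A ≡ r ℚ.* linear p q A
linear-* r p q (x , y) = factor r p q ⟦ x ⟧ ⟦ y ⟧
  where
  factor : ∀ r p q x y → r ℚ.* p ℚ.* x ℚ.+ r ℚ.* q ℚ.* y ≡ r ℚ.* (p ℚ.* x ℚ.+ q ℚ.* y)
  factor = solve-∀ ℚ-ring

module _ (ℓ : Line) where
  open Line ℓ

  offset : Sign → ℕ → ℚ
  offset s n = sgn s ℚ.* seq c n

  side : Sign → ℕ → ℤ² → ℚ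
  side s n = linear (sgn s ℚ.* seq a n) (sgn s ℚ.* seq b n)

  halfPlane⇒gap : ∀ s {A} → ι A ∈ halfPlane ℓ s →
    ∃[ ε ] (0ℚ ℚ.< ε × Eventually λ n → offset s n ℚ.+ ε ℚ.≤ side s n A)
  halfPlane⇒gap Sign.+ {A} (ε , 0<ε , gap) = ε , 0<ε , eventually-map (λ n →
    subst₂ (λ p q → p ℚ.+ ε ℚ.≤ q) (sym (ℚ.*-identityˡ (seq c n)))
      (sym (trans (linear-* 1ℚ (seq a n) (seq b n) A) (ℚ.*-identityˡ _)))) gap
  halfPlane⇒gap Sign.- {A} (ε , 0<ε , gap) = ε , 0<ε , eventually-map (λ n c+ε≤f →
    0≤-⇒≤ (subst (0ℚ ℚ.≤_)
      (trans (rearrange (seq c n) ε (linear (seq a n) (seq b n) A))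
        (cong (ℚ._- (ℚ.- 1ℚ ℚ.* seq c n ℚ.+ ε))
          (sym (linear-* (ℚ.- 1ℚ) (seq a n) (seq b n) A))))
      (≤⇒0≤- c+ε≤f))) gap
    where
    rearrange : ∀ c ε f → c ℚ.- (f ℚ.+ ε) ≡ ℚ.- 1ℚ ℚ.* f ℚ.- (ℚ.- 1ℚ ℚ.* c ℚ.+ ε)
    rearrange = solve-∀ ℚ-ring

  -- The constant term of a line through O tends to 0, so in absolute value it eventually drops
  -- below the gap `ε`, and what is left of the gap is positive.
  through-O⇒positive : ∀ s {A} → ι O ∈ points ℓ → ι A ∈ halfPlane ℓ s →
    Eventually λ n → 0ℚ ℚ.< side s n A
  through-O⇒positive s {A} O∈ℓ A∈ with halfPlane⇒gap s {A} A∈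
  ... | ε , 0<ε , gap = eventually-map (λ n (near , gap) → begin-strict
      0ℚ                                ≡⟨ ℚ.+-inverseˡ ε ⟨
      ℚ.- ε ℚ.+ ε
        <⟨ ℚ.+-monoˡ-< ε (ℚ.neg-antimono-< (subst (ℚ._< ε) (distance n) near)) ⟩
      ℚ.- ℚ.∣ offset s n ∣ ℚ.+ ε        ≤⟨ ℚ.+-monoˡ-≤ ε (-∣p∣≤p (offset s n)) ⟩
      offset s n ℚ.+ ε                  ≤⟨ gap ⟩
      side s n A                        ∎) (eventually-zip (O∈ℓ ε 0<ε) gap)
    where
    open ℚ.≤-Reasoning
    distance : ∀ n → ℚ.∣ linear (seq a n) (seq b n) O ℚ.- seq c n ∣ ≡ ℚ.∣ offset s n ∣
    distance n = trans
      (cong ℚ.∣_∣ (trans (cong (ℚ._- seq c n) (linear-O (seq a n) (seq b n)))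
                         (ℚ.+-identityˡ (ℚ.- seq c n))))
      (trans (ℚ.∣-p∣≡∣p∣ (seq c n)) (sym (∣sgn*∣ s (seq c n))))

  -- The form vanishes at O, so the gap at O is a lower bound for the signed constant term.
  opposite-O⇒offset : ∀ s → ι O ∈ halfPlane ℓ (opposite s) →
    ∃[ δ ] (0ℚ ℚ.< δ × Eventually λ n → δ ℚ.≤ offset s n)
  opposite-O⇒offset s O∈ with halfPlane⇒gap (opposite s) {O} O∈
  ... | ε , 0<ε , gap = ε , 0<ε , eventually-map (λ n gap →
      0≤-⇒≤ (subst (0ℚ ℚ.≤_) (trans (ℚ.+-identityˡ _) (negate s (seq c n)))
        (subst (λ r → 0ℚ ℚ.≤ r ℚ.- (offset (opposite s) n ℚ.+ ε))
          (linear-O (sgn (opposite s) ℚ.* seq a n) (sgn (opposite s) ℚ.* seq b n))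
          (≤⇒0≤- gap)))) gap
    where
    negate⁺ : ∀ c ε → ℚ.- (ℚ.- 1ℚ ℚ.* c ℚ.+ ε) ≡ 1ℚ ℚ.* c ℚ.- ε
    negate⁺ = solve-∀ ℚ-ring
    negate⁻ : ∀ c ε → ℚ.- (1ℚ ℚ.* c ℚ.+ ε) ≡ ℚ.- 1ℚ ℚ.* c ℚ.- ε
    negate⁻ = solve-∀ ℚ-ring
    negate : ∀ s c → ℚ.- (sgn (opposite s) ℚ.* c ℚ.+ ε) ≡ sgn s ℚ.* c ℚ.- ε
    negate Sign.+ c = negate⁺ c ε
    negate Sign.- c = negate⁻ c ε

-- Words over a step set in a half-plane

step≢O : ∀ X {A} → A ∈ steps X → A ≢ O
step≢O X A∈X refl = O∉ X A∈X

weight : (ℤ² → ℕ) → Word → ℕ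
weight g = foldr (λ A k → g A ℕ.+ k) 0

-- The functional is additive along the word. Taking `g` constantly 1 bounds lengths; taking `g` to
-- be `size` also bounds the steps themselves.
linear-α-≥ : ∀ p q δ g {w} → All (λ A → ⟦ + g A ⟧ ℚ.* δ ℚ.≤ linear p q A) w →
             ⟦ + weight g w ⟧ ℚ.* δ ℚ.≤ linear p q (α w)
linear-α-≥ p q δ g [] = ℚ.≤-reflexive (trans (ℚ.*-zeroˡ δ) (sym (linear-O p q)))
linear-α-≥ p q δ g {A ∷ w} (A≥ ∷ w≥) = begin
  ⟦ + (g A ℕ.+ weight g w) ⟧ ℚ.* δ                     ≡⟨ cong (ℚ._* δ) (⟦⟧-+ (+ g A) (+ weight g w)) ⟩
  (⟦ + g A ⟧ ℚ.+ ⟦ + weight g w ⟧) ℚ.* δ               ≡⟨ ℚ.*-distribʳ-+ δ ⟦ + g A ⟧ ⟦ + weight g w ⟧ ⟩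
  ⟦ + g A ⟧ ℚ.* δ ℚ.+ ⟦ + weight g w ⟧ ℚ.* δ           ≤⟨ ℚ.+-mono-≤ A≥ (linear-α-≥ p q δ g w≥) ⟩
  linear p q A ℚ.+ linear p q (α w)                    ≡⟨ linear-⊕ p q A (α w) ⟨
  linear p q (A ⊕ α w)                                 ∎
  where open ℚ.≤-Reasoning

linear-α-> : ∀ p q {A w} → All (λ A → 0ℚ ℚ.< linear p q A) (A ∷ w) → 0ℚ ℚ.< linear p q (α (A ∷ w))
linear-α-> p q {A} (0<A ∷ []) = subst (λ B → 0ℚ ℚ.< linear p q B) (sym (⊕-identityʳ A)) 0<A
linear-α-> p q {A} (_∷_ {xs = w} 0<A rest@(_ ∷ _)) =
  subst (0ℚ ℚ.<_) (sym (linear-⊕ p q A (α w))) (ℚ.+-mono-< 0<A (linear-α-> p q rest))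

length≤weight : ∀ {g w} → All (λ A → 1 ℕ.≤ g A) w → length w ℕ.≤ weight g w
length≤weight []           = z≤n
length≤weight (1≤g ∷ rest) = ℕ.+-mono-≤ 1≤g (length≤weight rest)

≤weight : ∀ g w → All (λ A → g A ℕ.≤ weight g w) w
≤weight g []      = []
≤weight g (A ∷ w) = ℕ.m≤m+n (g A) _ ∷ All.map (λ ≤w → ℕ.≤-trans ≤w (ℕ.m≤n+m _ (g A))) (≤weight g w)

-- Only the finitely many letters of `w` have to be made positive, so a single index of the Cauchy
-- sequences suffices. The rational functional obtained depends on `w`.
LC-separates : ∀ X {w} → LC X → w ∈ FreeMonoid X → ∃₂ λ p q → All (λ A → 0ℚ ℚ.< linear p q A) w
LC-separates X (ℓ , s , O∈ℓ , X⊆) w∈X* =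
  let N , positive = eventually-witness (eventually-All (All.map step-positive w∈X*))
  in sgn s ℚ.* seq (Line.a ℓ) N , sgn s ℚ.* seq (Line.b ℓ) N , positive
  where
  step-positive : ∀ {A} → A ∈ steps X → Eventually λ n → 0ℚ ℚ.< side ℓ s n A
  step-positive {A} A∈X = through-O⇒positive ℓ s {A} O∈ℓ (X⊆ {A} A∈X)

LC⇒no-loops : ∀ X {w} → LC X → w ∈ FreeMonoid X → α w ≡ O → w ≡ []
LC⇒no-loops X {[]}    _  _   _    = refl
LC⇒no-loops X {A ∷ w} lc w∈X* α≡O =
  let p , q , positive = LC-separates X lc w∈X*
  in contradiction
       (subst (0ℚ ℚ.<_) (trans (cong (linear p q) α≡O) (linear-O p q)) (linear-α-> p q positive))
       (ℚ.<-irrefl {0ℚ} refl)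

LC⇒¬IPP : ∀ X C → LC X → ¬ IPP X C
LC⇒¬IPP X C lc = no-loops⇒¬IPP X C λ ((w∈X* , _) , αw≡O) → LC⇒no-loops X lc w∈X* αw≡O

-- Every step contributes at least `δ`, while the total is at most `B`. The bound `N` depends on `A`
-- alone; only the index `n` at which the approximations are compared varies with the word.
SLC⇒BPP : ∀ X C → SLC X → BPP X C
SLC⇒BPP X C (ℓ , s , X⊆ , O∈) = bounded⇒BPP X C λ A →
  let B , _ , f≤B = eventually-bounded (form ℓ (ι A))
      N , bound   = archimedean 0<δ B
  in N , λ {w} w∈X* αw≡A →
    let n , steps≥ , f≤B = eventually-witness
          (eventually-zip (eventually-All (All.map step≥ w∈X*)) f≤B)
        f = linear (seq a n) (seq b n)
    in ℕ.≤-trans (length≤weight (All.universal (λ _ → ℕ.≤-refl) w)) (bound (begin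
      ⟦ + weight (λ _ → 1) w ⟧ ℚ.* δ
        ≤⟨ linear-α-≥ (sgn s ℚ.* seq a n) (sgn s ℚ.* seq b n) δ (λ _ → 1) steps≥ ⟩
      side ℓ s n (α w)           ≡⟨ cong (side ℓ s n) αw≡A ⟩
      side ℓ s n A               ≤⟨ p≤∣p∣ (side ℓ s n A) ⟩
      ℚ.∣ side ℓ s n A ∣         ≡⟨ cong ℚ.∣_∣ (linear-* (sgn s) (seq a n) (seq b n) A) ⟩
      ℚ.∣ sgn s ℚ.* f A ∣        ≡⟨ ∣sgn*∣ s (f A) ⟩
      ℚ.∣ f A ∣                  ≤⟨ f≤B ⟩
      B                          ∎))
  where
  open Line ℓ
  open ℚ.≤-Reasoning
  gap-at-O = opposite-O⇒offset ℓ s O∈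
  δ        = proj₁ gap-at-O
  0<δ      = proj₁ (proj₂ gap-at-O)
  δ≤offset = proj₂ (proj₂ gap-at-O)

  step≥ : ∀ {A} → A ∈ steps X → Eventually λ n → 1ℚ ℚ.* δ ℚ.≤ side ℓ s n A
  step≥ {A} A∈X =
    let ε , 0<ε , gap = halfPlane⇒gap ℓ s {A} (X⊆ A∈X)
    in eventually-map (λ n (δ≤offset , gap) → begin
      1ℚ ℚ.* δ              ≡⟨ ℚ.*-identityˡ δ ⟩
      δ                     ≤⟨ δ≤offset ⟩
      offset ℓ s n          ≤⟨ ≤+ˡ (offset ℓ s n) 0<ε ⟩
      offset ℓ s n ℚ.+ ε    ≤⟨ gap ⟩
      side ℓ s n A          ∎) (eventually-zip δ≤offset gap)

-- The line is translated to O by replacing `c` with 0. On the positive side 0 < c < f(A), so the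
-- gap between `c` and f(A) also separates 0 from f(A); the other side is symmetric.
SLC⇒LC : ∀ X → SLC X → LC X
SLC⇒LC X (ℓ , s , X⊆ , O∈) = ℓ₀ , s , O∈lineThroughO a b nontrivial , λ A∈X → translate s {_} (X⊆ A∈X) O∈
  where
  open Line ℓ
  ℓ₀ : Line
  ℓ₀ = lineThroughO a b nontrivial

  <-≤ : ∀ {ε} p {q r} → 0ℚ ℚ.< ε → p ℚ.+ ε ℚ.≤ q → q ℚ.≤ r → p ℚ.≤ r
  <-≤ p 0<ε p+ε≤q q≤r = ℚ.≤-trans (≤+ˡ p 0<ε) (ℚ.≤-trans p+ε≤q q≤r)

  translate : ∀ s {P} → P ∈ halfPlane ℓ s → ι O ∈ halfPlane ℓ (opposite s) → P ∈ halfPlane ℓ₀ s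
  translate Sign.+ (ε , 0<ε , c<P) (ε′ , 0<ε′ , O<c) = ε , 0<ε , eventually-map
    (λ n (c<P , O<c) → ℚ.≤-trans (ℚ.+-monoˡ-≤ ε
      (<-≤ 0ℚ 0<ε′ (subst (λ r → r ℚ.+ ε′ ℚ.≤ seq c n) (linear-O (seq a n) (seq b n)) O<c) ℚ.≤-refl)) c<P)
    (eventually-zip c<P O<c)
  translate Sign.- (ε , 0<ε , P<c) (ε′ , 0<ε′ , c<O) = ε , 0<ε , eventually-map
    (λ n (P<c , c<O) → ℚ.≤-trans P<c
      (<-≤ (seq c n) 0<ε′ c<O (ℚ.≤-reflexive (linear-O (seq a n) (seq b n)))))
    (eventually-zip P<c c<O)

-- Coercive step sets

-- The field `p,q≢0` lets the functional define a line; the inequality alone does not guarantee this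
-- when `X` is empty.
record Coercive (X : StepSet) : Set where
  field
    p q κ    : ℚ
    p,q≢0    : p ≢ 0ℚ ⊎ q ≢ 0ℚ
    0<κ      : 0ℚ ℚ.< κ
    coercive : ∀ {A} → A ∈ steps X → κ ℚ.* norm A ℚ.≤ linear p q A

coercive⇒positive : ∀ {p q κ A} → 0ℚ ℚ.< κ → A ≢ O →
                    κ ℚ.* norm A ℚ.≤ linear p q A → κ ℚ.≤ linear p q A
coercive⇒positive {κ = κ} {A} 0<κ A≢O κ≤ = ℚ.≤-trans
  (subst (ℚ._≤ κ ℚ.* norm A) (ℚ.*-identityʳ κ) (*-monoˡ-≤ (ℚ.<⇒≤ 0<κ) (1≤norm A≢O))) κ≤

-- If p = q = 0 then X is empty, and any other functional will do.
mkCoercive : ∀ X p q κ → 0ℚ ℚ.< κ →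
             (∀ {A} → A ∈ steps X → κ ℚ.* norm A ℚ.≤ linear p q A) → Coercive X
mkCoercive X p q κ 0<κ coercive with p ℚ.≟ 0ℚ | q ℚ.≟ 0ℚ
... | no p≢0   | _        = record
  { p = p ; q = q ; p,q≢0 = inj₁ p≢0 ; 0<κ = 0<κ ; coercive = coercive }
... | yes _    | no q≢0   = record
  { p = p ; q = q ; p,q≢0 = inj₂ q≢0 ; 0<κ = 0<κ ; coercive = coercive }
... | yes refl | yes refl = record
  { p = 1ℚ ; q = 0ℚ ; p,q≢0 = inj₁ ℚ.1≢0 ; 0<κ = 0<κ
  ; coercive = λ {A} A∈X → contradiction
      (ℚ.<-≤-trans 0<κ (coercive⇒positive {0ℚ} {0ℚ} {κ} {A} 0<κ (step≢O X A∈X) (coercive A∈X)))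
      (ℚ.<-irrefl (sym (cong₂ ℚ._+_ (ℚ.*-zeroˡ ⟦ proj₁ A ⟧) (ℚ.*-zeroˡ ⟦ proj₂ A ⟧))))
  }

⊓-pos : ∀ p q → 0ℚ ℚ.< p → 0ℚ ℚ.< q → 0ℚ ℚ.< p ℚ.⊓ q
⊓-pos p q 0<p 0<q with ℚ.⊓-sel p q
... | inj₁ ≡p = subst (0ℚ ℚ.<_) (sym ≡p) 0<p
... | inj₂ ≡q = subst (0ℚ ℚ.<_) (sym ≡q) 0<q

-- The constant is the least among 1 and the quotients f(A) / (1 + norm A), where the added 1 keeps
-- the divisors positive.
finite-coercive : ∀ p q {xs} → All (λ A → 0ℚ ℚ.< linear p q A) xs →
  ∃[ κ ] (0ℚ ℚ.< κ × All (λ A → κ ℚ.* norm A ℚ.≤ linear p q A) xs)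
finite-coercive p q [] = 1ℚ , 0<1ℚ , []
finite-coercive p q {A ∷ xs} (0<A ∷ 0<xs) =
  let κ , 0<κ , κ≤xs = finite-coercive p q 0<xs
      δ , 0<δ , δ≤A  = scale
  in κ ℚ.⊓ δ , ⊓-pos κ δ 0<κ 0<δ ,
     ℚ.≤-trans (*-monoʳ-≤ (0≤norm A) (ℚ.p⊓q≤q κ δ)) δ≤A ∷
     All.map (λ {B} κ≤B → ℚ.≤-trans (*-monoʳ-≤ (0≤norm B) (ℚ.p⊓q≤p κ δ)) κ≤B) κ≤xs
  where
  open ℚ.≤-Reasoning
  scale : ∃[ δ ] (0ℚ ℚ.< δ × δ ℚ.* norm A ℚ.≤ linear p q A)
  scale =
    let δ , 0<δ , δ-eq = divide (1ℚ ℚ.+ norm A) (linear p q A) (ℚ.+-mono-<-≤ 0<1ℚ (0≤norm A)) 0<A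
    in δ , 0<δ , (begin
      δ ℚ.* norm A               ≤⟨ *-monoˡ-≤ (ℚ.<⇒≤ 0<δ) (≤+ʳ (norm A) 0<1ℚ) ⟩
      δ ℚ.* (1ℚ ℚ.+ norm A)      ≡⟨ ℚ.*-comm δ (1ℚ ℚ.+ norm A) ⟩
      (1ℚ ℚ.+ norm A) ℚ.* δ      ≡⟨ δ-eq ⟩
      linear p q A               ∎)

finite∧LC⇒Coercive : ∀ X → FiniteStepSet X → LC X → Coercive X
finite∧LC⇒Coercive X (xs , X⊆xs , xs⊆X) lc =
  -- The list enumerating `X` is itself a word over `X`, so one rational functional is positive on
  -- all steps.
  let p , q , positive = LC-separates X {xs} lc (All.tabulate xs⊆X)
      κ , 0<κ , κ≤     = finite-coercive p q positive
  in mkCoercive X p q κ 0<κ (λ A∈X → All.lookup κ≤ (X⊆xs A∈X))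

-- The index in the hypothesis depends on `A`, and `X` may be infinite. But exchanging the
-- coefficients at a late index for those at `N` changes the value at `A` by at most `h` times its
-- norm, with `N` independent of `A`, so half of `κ = 2h` survives.
eventually-coercive⇒Coercive : ∀ X x y κ → 0ℚ ℚ.< κ →
  (∀ {A} → A ∈ steps X → Eventually λ n → κ ℚ.* norm A ℚ.≤ linear (seq x n) (seq y n) A) →
  Coercive X
eventually-coercive⇒Coercive X x y κ 0<κ eventually =
  mkCoercive X (seq x N) (seq y N) h 0<h bound
  where
  open ℚ.≤-Reasoning
  halving = divide (1ℚ ℚ.+ 1ℚ) κ (ℚ.positive⁻¹ (1ℚ ℚ.+ 1ℚ)) 0<κ
  h       = proj₁ halving
  0<h     = proj₁ (proj₂ halving)
  2h≡κ    = proj₂ (proj₂ halving)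
  Nx      = proj₁ (cauchy x h 0<h)
  Ny      = proj₁ (cauchy y h 0<h)
  N       = Nx ℕ.⊔ Ny

  double : ∀ h k → (1ℚ ℚ.+ 1ℚ) ℚ.* h ℚ.* k ℚ.- h ℚ.* k ≡ h ℚ.* k
  double = solve-∀ ℚ-ring

  difference : ∀ p q p′ q′ u v →
    (p ℚ.* u ℚ.+ q ℚ.* v) ℚ.- ((p ℚ.- p′) ℚ.* u ℚ.+ (q ℚ.- q′) ℚ.* v) ≡ p′ ℚ.* u ℚ.+ q′ ℚ.* v
  difference = solve-∀ ℚ-ring

  close : ∀ {n} → N ℕ.≤ n → ∀ A →
          ℚ.∣ linear (seq x n ℚ.- seq x N) (seq y n ℚ.- seq y N) A ∣ ℚ.≤ h ℚ.* norm A
  close {n} N≤n A = ∣linear∣≤ A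
    (ℚ.<⇒≤ (proj₂ (cauchy x h 0<h) n N (ℕ.m⊔n≤o⇒m≤o Nx Ny N≤n) (ℕ.m≤m⊔n Nx Ny)))
    (ℚ.<⇒≤ (proj₂ (cauchy y h 0<h) n N (ℕ.m⊔n≤o⇒n≤o Nx Ny N≤n) (ℕ.m≤n⊔m Nx Ny)))

  bound : ∀ {A} → A ∈ steps X → h ℚ.* norm A ℚ.≤ linear (seq x N) (seq y N) A
  bound {A} A∈X =
    let n , N≤n , κ≤ = eventually-witness (eventually-zip (N , λ _ N≤n → N≤n) (eventually A∈X))
        p = seq x n ; q = seq y n
        Δ = linear (p ℚ.- seq x N) (q ℚ.- seq y N) A
    in begin
      h ℚ.* norm A
        ≡⟨ double h (norm A) ⟨
      (1ℚ ℚ.+ 1ℚ) ℚ.* h ℚ.* norm A ℚ.- h ℚ.* norm A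
        ≡⟨ cong (λ r → r ℚ.* norm A ℚ.- h ℚ.* norm A) 2h≡κ ⟩
      κ ℚ.* norm A ℚ.- h ℚ.* norm A
        ≤⟨ ℚ.+-mono-≤ κ≤ (ℚ.neg-antimono-≤ (ℚ.≤-trans (p≤∣p∣ Δ) (close N≤n A))) ⟩
      linear p q A ℚ.- Δ
        ≡⟨ difference p q (seq x N) (seq y N) ⟦ proj₁ A ⟧ ⟦ proj₂ A ⟧ ⟩
      linear (seq x N) (seq y N) A ∎

-- Cramer's rule: det · x = u b₂ − v b₁ and det · y = v a₁ − u a₂, where u and v
-- are the values of the two functionals at (x , y).
det-bound : ∀ a₁ b₁ a₂ b₂ {B} A →
  ℚ.∣ a₁ ∣ ℚ.≤ B → ℚ.∣ b₁ ∣ ℚ.≤ B → ℚ.∣ a₂ ∣ ℚ.≤ B → ℚ.∣ b₂ ∣ ℚ.≤ B →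
  0ℚ ℚ.≤ linear a₁ b₁ A → 0ℚ ℚ.≤ linear a₂ b₂ A →
  ℚ.∣ a₁ ℚ.* b₂ ℚ.- a₂ ℚ.* b₁ ∣ ℚ.* norm A ℚ.≤ (B ℚ.+ B) ℚ.* linear (a₁ ℚ.+ a₂) (b₁ ℚ.+ b₂) A
det-bound a₁ b₁ a₂ b₂ {B} A@(i , j) ∣a₁∣≤B ∣b₁∣≤B ∣a₂∣≤B ∣b₂∣≤B 0≤u 0≤v = begin
  ℚ.∣ det ∣ ℚ.* norm A
    ≡⟨ ℚ.*-distribˡ-+ ℚ.∣ det ∣ ℚ.∣ x ∣ ℚ.∣ y ∣ ⟩
  ℚ.∣ det ∣ ℚ.* ℚ.∣ x ∣ ℚ.+ ℚ.∣ det ∣ ℚ.* ℚ.∣ y ∣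
    ≡⟨ cong₂ ℚ._+_ (ℚ.∣p*q∣≡∣p∣*∣q∣ det x) (ℚ.∣p*q∣≡∣p∣*∣q∣ det y) ⟨
  ℚ.∣ det ℚ.* x ∣ ℚ.+ ℚ.∣ det ℚ.* y ∣
    ≡⟨ cong₂ (λ r s → ℚ.∣ r ∣ ℚ.+ ℚ.∣ s ∣)
         (cramer-x a₁ b₁ a₂ b₂ x y) (cramer-y a₁ b₁ a₂ b₂ x y) ⟩
  ℚ.∣ u ℚ.* b₂ ℚ.- v ℚ.* b₁ ∣ ℚ.+ ℚ.∣ v ℚ.* a₁ ℚ.- u ℚ.* a₂ ∣
    ≤⟨ ℚ.+-mono-≤ (combine 0≤u 0≤v ∣b₂∣≤B ∣b₁∣≤B)
                    (combine 0≤v 0≤u ∣a₁∣≤B ∣a₂∣≤B) ⟩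
  (u ℚ.* B ℚ.+ v ℚ.* B) ℚ.+ (v ℚ.* B ℚ.+ u ℚ.* B)
    ≡⟨ collect a₁ b₁ a₂ b₂ x y B ⟩
  (B ℚ.+ B) ℚ.* linear (a₁ ℚ.+ a₂) (b₁ ℚ.+ b₂) A ∎
  where
  open ℚ.≤-Reasoning
  x = ⟦ i ⟧
  y = ⟦ j ⟧
  det = a₁ ℚ.* b₂ ℚ.- a₂ ℚ.* b₁
  u = linear a₁ b₁ A
  v = linear a₂ b₂ A

  cramer-x : ∀ a₁ b₁ a₂ b₂ x y → (a₁ ℚ.* b₂ ℚ.- a₂ ℚ.* b₁) ℚ.* x ≡
    (a₁ ℚ.* x ℚ.+ b₁ ℚ.* y) ℚ.* b₂ ℚ.- (a₂ ℚ.* x ℚ.+ b₂ ℚ.* y) ℚ.* b₁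
  cramer-x = solve-∀ ℚ-ring

  cramer-y : ∀ a₁ b₁ a₂ b₂ x y → (a₁ ℚ.* b₂ ℚ.- a₂ ℚ.* b₁) ℚ.* y ≡
    (a₂ ℚ.* x ℚ.+ b₂ ℚ.* y) ℚ.* a₁ ℚ.- (a₁ ℚ.* x ℚ.+ b₁ ℚ.* y) ℚ.* a₂
  cramer-y = solve-∀ ℚ-ring

  collect : ∀ a₁ b₁ a₂ b₂ x y B →
    ((a₁ ℚ.* x ℚ.+ b₁ ℚ.* y) ℚ.* B ℚ.+ (a₂ ℚ.* x ℚ.+ b₂ ℚ.* y) ℚ.* B) ℚ.+
    ((a₂ ℚ.* x ℚ.+ b₂ ℚ.* y) ℚ.* B ℚ.+ (a₁ ℚ.* x ℚ.+ b₁ ℚ.* y) ℚ.* B) ≡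
    (B ℚ.+ B) ℚ.* ((a₁ ℚ.+ a₂) ℚ.* x ℚ.+ (b₁ ℚ.+ b₂) ℚ.* y)
  collect = solve-∀ ℚ-ring

  combine : ∀ {r s p q} → 0ℚ ℚ.≤ r → 0ℚ ℚ.≤ s → ℚ.∣ p ∣ ℚ.≤ B → ℚ.∣ q ∣ ℚ.≤ B →
            ℚ.∣ r ℚ.* p ℚ.- s ℚ.* q ∣ ℚ.≤ r ℚ.* B ℚ.+ s ℚ.* B
  combine {r} {s} {p} {q} 0≤r 0≤s p≤B q≤B = begin
    ℚ.∣ r ℚ.* p ℚ.- s ℚ.* q ∣                        ≤⟨ ℚ.∣p-q∣≤∣p∣+∣q∣ (r ℚ.* p) (s ℚ.* q) ⟩
    ℚ.∣ r ℚ.* p ∣ ℚ.+ ℚ.∣ s ℚ.* q ∣                  ≡⟨ cong₂ ℚ._+_ (ℚ.∣p*q∣≡∣p∣*∣q∣ r p) (ℚ.∣p*q∣≡∣p∣*∣q∣ s q) ⟩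
    ℚ.∣ r ∣ ℚ.* ℚ.∣ p ∣ ℚ.+ ℚ.∣ s ∣ ℚ.* ℚ.∣ q ∣
      ≡⟨ cong₂ (λ r s → r ℚ.* ℚ.∣ p ∣ ℚ.+ s ℚ.* ℚ.∣ q ∣) (ℚ.0≤p⇒∣p∣≡p 0≤r) (ℚ.0≤p⇒∣p∣≡p 0≤s) ⟩
    r ℚ.* ℚ.∣ p ∣ ℚ.+ s ℚ.* ℚ.∣ q ∣                  ≤⟨ ℚ.+-mono-≤ (*-monoˡ-≤ 0≤r p≤B) (*-monoˡ-≤ 0≤s q≤B) ⟩
    r ℚ.* B ℚ.+ s ℚ.* B                              ∎

#⇒∣-∣ : ∀ {x y} → x # y → ∃[ δ ] (0ℚ ℚ.< δ × Eventually λ n → δ ℚ.≤ ℚ.∣ seq x n ℚ.- seq y n ∣)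
#⇒∣-∣ {x} {y} (inj₁ (δ , 0<δ , gap)) = δ , 0<δ , eventually-map (λ n x+δ≤y →
  subst (δ ℚ.≤_)
    (trans (sym (ℚ.∣-p∣≡∣p∣ (seq y n ℚ.- seq x n))) (cong ℚ.∣_∣ (swap (seq x n) (seq y n))))
    (ℚ.≤-trans (move (seq x n) x+δ≤y) (p≤∣p∣ (seq y n ℚ.- seq x n)))) gap
  where
  swap : ∀ p q → ℚ.- (q ℚ.- p) ≡ p ℚ.- q
  swap = solve-∀ ℚ-ring
  shift : ∀ p δ → p ℚ.+ δ ℚ.- p ≡ δ
  shift = solve-∀ ℚ-ring
  move : ∀ p {q} → p ℚ.+ δ ℚ.≤ q → δ ℚ.≤ q ℚ.- p
  move p {q} le = subst (ℚ._≤ q ℚ.- p) (shift p δ) (ℚ.+-monoˡ-≤ (ℚ.- p) le)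
#⇒∣-∣ {x} {y} (inj₂ (δ , 0<δ , gap)) = δ , 0<δ , eventually-map (λ n y+δ≤x →
  ℚ.≤-trans (subst (ℚ._≤ seq x n ℚ.- seq y n) (shift (seq y n) δ) (ℚ.+-monoˡ-≤ (ℚ.- seq y n) y+δ≤x))
    (p≤∣p∣ (seq x n ℚ.- seq y n))) gap
  where
  shift : ∀ p δ → p ℚ.+ δ ℚ.- p ≡ δ
  shift = solve-∀ ℚ-ring

∣det-sgn∣ : ∀ s₁ s₂ a₁ b₁ a₂ b₂ →
  ℚ.∣ (sgn s₁ ℚ.* a₁) ℚ.* (sgn s₂ ℚ.* b₂) ℚ.- (sgn s₂ ℚ.* a₂) ℚ.* (sgn s₁ ℚ.* b₁) ∣ ≡
  ℚ.∣ a₁ ℚ.* b₂ ℚ.- a₂ ℚ.* b₁ ∣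
∣det-sgn∣ s₁ s₂ a₁ b₁ a₂ b₂ = trans (cong ℚ.∣_∣ (factor (sgn s₁) (sgn s₂) a₁ b₁ a₂ b₂))
  (trans (∣sgn*∣ s₁ _) (∣sgn*∣ s₂ _))
  where
  factor : ∀ r s a₁ b₁ a₂ b₂ →
    (r ℚ.* a₁) ℚ.* (s ℚ.* b₂) ℚ.- (s ℚ.* a₂) ℚ.* (r ℚ.* b₁) ≡
    r ℚ.* (s ℚ.* (a₁ ℚ.* b₂ ℚ.- a₂ ℚ.* b₁))
  factor = solve-∀ ℚ-ring

-- By `det-bound` the sum of the two signed functionals is eventually at least δ / 2B times the
-- norm, where `δ` keeps the determinant away from 0 and `B` dominates all four coefficients.
-- Positivity of the functionals sets in at an index depending on `A`, hence the passage through
-- `eventually-coercive⇒Coercive`.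
CC⇒Coercive : ∀ X → CC X → Coercive X
CC⇒Coercive X (K , (O∈ℓ₁ , O∈ℓ₂) , X⊆) =
  let δ , 0<δ , δ≤det   = #⇒∣-∣ {Line.a ℓ₁ * Line.b ℓ₂} {Line.a ℓ₂ * Line.b ℓ₁} (Cone.nonParallel K)
      B₁ , 0<B₁ , a₁≤B₁ = eventually-bounded (Line.a ℓ₁)
      B₂ , 0<B₂ , b₁≤B₂ = eventually-bounded (Line.b ℓ₁)
      B₃ , 0<B₃ , a₂≤B₃ = eventually-bounded (Line.a ℓ₂)
      B₄ , 0<B₄ , b₂≤B₄ = eventually-bounded (Line.b ℓ₂)
      B                 = (B₁ ℚ.+ B₂) ℚ.+ (B₃ ℚ.+ B₄)
      0<B₁₂             = ℚ.+-mono-< 0<B₁ 0<B₂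
      0<B₃₄             = ℚ.+-mono-< 0<B₃ 0<B₄
      0<B+B             = ℚ.+-mono-< (ℚ.+-mono-< 0<B₁₂ 0<B₃₄) (ℚ.+-mono-< 0<B₁₂ 0<B₃₄)
      B₁₂≤B             = ≤+ˡ (B₁ ℚ.+ B₂) 0<B₃₄
      B₃₄≤B             = ≤+ʳ (B₃ ℚ.+ B₄) 0<B₁₂
      κ , 0<κ , 2Bκ≡δ   = divide (B ℚ.+ B) δ 0<B+B 0<δ
  in eventually-coercive⇒Coercive X
       (fromℚ (sgn s₁) * Line.a ℓ₁ + fromℚ (sgn s₂) * Line.a ℓ₂)
       (fromℚ (sgn s₁) * Line.b ℓ₁ + fromℚ (sgn s₂) * Line.b ℓ₂) κ 0<κ λ {A} A∈X →
    eventually-map (λ n (δ≤det , (a₁≤B₁ , b₁≤B₂) , (a₂≤B₃ , b₂≤B₄) , 0<u , 0<v) →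
      let a₁ = sgn s₁ ℚ.* seq (Line.a ℓ₁) n
          b₁ = sgn s₁ ℚ.* seq (Line.b ℓ₁) n
          a₂ = sgn s₂ ℚ.* seq (Line.a ℓ₂) n
          b₂ = sgn s₂ ℚ.* seq (Line.b ℓ₂) n
      in *-cancelˡ-≤ 0<B+B (begin
        (B ℚ.+ B) ℚ.* (κ ℚ.* norm A)                        ≡⟨ ℚ.*-assoc (B ℚ.+ B) κ (norm A) ⟨
        (B ℚ.+ B) ℚ.* κ ℚ.* norm A                          ≡⟨ cong (ℚ._* norm A) 2Bκ≡δ ⟩
        δ ℚ.* norm A                                        ≤⟨ *-monoʳ-≤ (0≤norm A) δ≤det ⟩
        ℚ.∣ seq (Line.a ℓ₁) n ℚ.* seq (Line.b ℓ₂) n ℚ.- seq (Line.a ℓ₂) n ℚ.* seq (Line.b ℓ₁) n ∣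
          ℚ.* norm A
          ≡⟨ cong (ℚ._* norm A) (∣det-sgn∣ s₁ s₂ (seq (Line.a ℓ₁) n) (seq (Line.b ℓ₁) n)
                                                 (seq (Line.a ℓ₂) n) (seq (Line.b ℓ₂) n)) ⟨
        ℚ.∣ a₁ ℚ.* b₂ ℚ.- a₂ ℚ.* b₁ ∣ ℚ.* norm A
          ≤⟨ det-bound a₁ b₁ a₂ b₂ A
               (signed s₁ a₁≤B₁ (ℚ.≤-trans (≤+ˡ B₁ 0<B₂) B₁₂≤B))
               (signed s₁ b₁≤B₂ (ℚ.≤-trans (≤+ʳ B₂ 0<B₁) B₁₂≤B))
               (signed s₂ a₂≤B₃ (ℚ.≤-trans (≤+ˡ B₃ 0<B₄) B₃₄≤B))
               (signed s₂ b₂≤B₄ (ℚ.≤-trans (≤+ʳ B₄ 0<B₃) B₃₄≤B))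
               (ℚ.<⇒≤ 0<u) (ℚ.<⇒≤ 0<v) ⟩
        (B ℚ.+ B) ℚ.* linear (a₁ ℚ.+ a₂) (b₁ ℚ.+ b₂) A      ∎))
    (eventually-zip δ≤det
      (eventually-zip (eventually-zip a₁≤B₁ b₁≤B₂)
      (eventually-zip (eventually-zip a₂≤B₃ b₂≤B₄)
      (eventually-zip (through-O⇒positive ℓ₁ s₁ {A} O∈ℓ₁ (proj₁ (X⊆ {A} A∈X)))
                      (through-O⇒positive ℓ₂ s₂ {A} O∈ℓ₂ (proj₂ (X⊆ {A} A∈X)))))))
  where
  open ℚ.≤-Reasoning
  ℓ₁ = Cone.line₁ K
  ℓ₂ = Cone.line₂ K
  s₁ = Cone.side₁ K
  s₂ = Cone.side₂ K

  signed : ∀ s {p B C} → ℚ.∣ p ∣ ℚ.≤ B → B ℚ.≤ C → ℚ.∣ sgn s ℚ.* p ∣ ℚ.≤ C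
  signed s {p} p≤B B≤C = ℚ.≤-trans (subst (ℚ._≤ _) (sym (∣sgn*∣ s p)) p≤B) B≤C

0<p*p : ∀ {p} → p ≢ 0ℚ → 0ℚ ℚ.< p ℚ.* p
0<p*p {p} p≢0 with ℚ.<-cmp p 0ℚ
... | tri< p<0 _ _ = ℚ.positive⁻¹ (p ℚ.* p)
  {{ℚ.neg*neg⇒pos p {{ℚ.negative p<0}} p {{ℚ.negative p<0}}}}
... | tri≈ _ p≡0 _ = contradiction p≡0 p≢0
... | tri> _ _ 0<p = *-pos 0<p 0<p

0≤p*p : ∀ p → 0ℚ ℚ.≤ p ℚ.* p
0≤p*p p with p ℚ.≟ 0ℚ
... | yes refl = ℚ.≤-refl
... | no p≢0   = ℚ.<⇒≤ (0<p*p p≢0)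

0<p²+q² : ∀ {p q} → p ≢ 0ℚ ⊎ q ≢ 0ℚ → 0ℚ ℚ.< p ℚ.* p ℚ.+ q ℚ.* q
0<p²+q² {p} {q} (inj₁ p≢0) = ℚ.+-mono-<-≤ (0<p*p p≢0) (0≤p*p q)
0<p²+q² {p} {q} (inj₂ q≢0) = ℚ.+-mono-≤-< (0≤p*p p) (0<p*p q≢0)

det≢0⇒row≢0 : ∀ a b c d → a ℚ.* d ≢ c ℚ.* b → a ≢ 0ℚ ⊎ b ≢ 0ℚ
det≢0⇒row≢0 a b c d det≢0 with a ℚ.≟ 0ℚ | b ℚ.≟ 0ℚ
... | no a≢0   | _        = inj₁ a≢0
... | yes _    | no b≢0   = inj₂ b≢0
... | yes refl | yes refl = contradiction (trans (ℚ.*-zeroˡ d) (sym (ℚ.*-zeroʳ c))) det≢0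

rationalLine : ∀ p q c → p ≢ 0ℚ ⊎ q ≢ 0ℚ → Line
rationalLine p q c p,q≢0 = record
  { a = fromℚ p ; b = fromℚ q ; c = fromℚ c ; nontrivial = Sum.map fromℚ-# fromℚ-# p,q≢0 }

O∈rationalLine : ∀ p q p,q≢0 → ι O ∈ points (rationalLine p q 0ℚ p,q≢0)
O∈rationalLine p q p,q≢0 =
  O∈lineThroughO (fromℚ p) (fromℚ q) (Sum.map fromℚ-# fromℚ-# p,q≢0)

-- The line f = h with 0 < h < κ separates O, where f vanishes, from the steps, where the norm is at
-- least 1 and thus f ≥ κ.
Coercive⇒SLC : ∀ X → Coercive X → SLC X
Coercive⇒SLC X coercive-X = rationalLine p q h p,q≢0 , Sign.+ ,
  (λ {A} A∈X → fromℚ-mono-< {h} {linear p q A}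
    (ℚ.<-≤-trans h<κ (coercive⇒positive {p} {q} {κ} {A} 0<κ (step≢O X A∈X) (coercive A∈X)))) ,
  fromℚ-mono-< {linear p q O} {h} (subst (ℚ._< h) (sym (linear-O p q)) 0<h)
  where
  open Coercive coercive-X
  between = ℚ.<-dense 0<κ
  h       = proj₁ between
  0<h     = proj₁ (proj₂ between)
  h<κ     = proj₂ (proj₂ between)

-- The functional f = (p , q) is tilted to M f ± κ g, where g = (−q , p) is
-- perpendicular to it and M is so large that κ ∣ g ∣ ≤ (M − 1) f on the steps.
Coercive⇒CC : ∀ X → Coercive X → CC X
Coercive⇒CC X coercive-X =
  cone , (O∈rationalLine a₁ b₁ row₁ , O∈rationalLine a₂ b₂ row₂) , λ {A} A∈X →
  fromℚ-mono-< {0ℚ} {linear a₁ b₁ A} (subst (0ℚ ℚ.<_) (sym (tilt₁ M p q κ ⟦ proj₁ A ⟧ ⟦ proj₂ A ⟧))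
    (dominates A∈X (ℚ.≤-reflexive refl))) ,
  fromℚ-mono-< {0ℚ} {linear a₂ b₂ A} (subst (0ℚ ℚ.<_) (sym (tilt₂ M p q κ ⟦ proj₁ A ⟧ ⟦ proj₂ A ⟧))
    (dominates A∈X (ℚ.≤-reflexive (ℚ.∣-p∣≡∣p∣ (g A)))))
  where
  open Coercive coercive-X
  open ℚ.≤-Reasoning
  L = ℚ.∣ p ∣ ℚ.+ ℚ.∣ q ∣
  M = 1ℚ ℚ.+ L
  a₁ = M ℚ.* p ℚ.- κ ℚ.* q
  b₁ = M ℚ.* q ℚ.+ κ ℚ.* p
  a₂ = M ℚ.* p ℚ.+ κ ℚ.* q
  b₂ = M ℚ.* q ℚ.- κ ℚ.* p

  g : ℤ² → ℚ
  g = linear (ℚ.- q) p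

  0≤L : 0ℚ ℚ.≤ L
  0≤L = ℚ.+-mono-≤ (ℚ.0≤∣p∣ p) (ℚ.0≤∣p∣ q)

  tilt₁ : ∀ M p q κ x y → (M ℚ.* p ℚ.- κ ℚ.* q) ℚ.* x ℚ.+ (M ℚ.* q ℚ.+ κ ℚ.* p) ℚ.* y ≡
    M ℚ.* (p ℚ.* x ℚ.+ q ℚ.* y) ℚ.+ κ ℚ.* (ℚ.- q ℚ.* x ℚ.+ p ℚ.* y)
  tilt₁ = solve-∀ ℚ-ring

  tilt₂ : ∀ M p q κ x y → (M ℚ.* p ℚ.+ κ ℚ.* q) ℚ.* x ℚ.+ (M ℚ.* q ℚ.- κ ℚ.* p) ℚ.* y ≡
    M ℚ.* (p ℚ.* x ℚ.+ q ℚ.* y) ℚ.+ κ ℚ.* (ℚ.- (ℚ.- q ℚ.* x ℚ.+ p ℚ.* y))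
  tilt₂ = solve-∀ ℚ-ring

  -- The positive difference 2Mκ(p² + q²) is what makes the tilted lines nonparallel.
  det : ∀ M p q κ → (M ℚ.* p ℚ.- κ ℚ.* q) ℚ.* (M ℚ.* q ℚ.- κ ℚ.* p)
    ℚ.+ (M ℚ.* κ ℚ.+ M ℚ.* κ) ℚ.* (p ℚ.* p ℚ.+ q ℚ.* q) ≡
    (M ℚ.* p ℚ.+ κ ℚ.* q) ℚ.* (M ℚ.* q ℚ.+ κ ℚ.* p)
  det = solve-∀ ℚ-ring

  0<M*κ : 0ℚ ℚ.< M ℚ.* κ
  0<M*κ = *-pos (ℚ.+-mono-<-≤ 0<1ℚ 0≤L) 0<κ

  det< : a₁ ℚ.* b₂ ℚ.< a₂ ℚ.* b₁
  det< = subst₂ ℚ._<_ (ℚ.+-identityʳ (a₁ ℚ.* b₂)) (det M p q κ)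
    (ℚ.+-monoʳ-< (a₁ ℚ.* b₂) (*-pos (ℚ.+-mono-< 0<M*κ 0<M*κ) (0<p²+q² p,q≢0)))

  row₁ : a₁ ≢ 0ℚ ⊎ b₁ ≢ 0ℚ
  row₁ = det≢0⇒row≢0 a₁ b₁ a₂ b₂ (ℚ.<⇒≢ det<)

  row₂ : a₂ ≢ 0ℚ ⊎ b₂ ≢ 0ℚ
  row₂ = det≢0⇒row≢0 a₂ b₂ a₁ b₁ (ℚ.<⇒≢ det< ∘ sym)

  cone : Cone
  cone = record
    { line₁ = rationalLine a₁ b₁ 0ℚ row₁ ; line₂ = rationalLine a₂ b₂ 0ℚ row₂
    ; side₁ = Sign.+ ; side₂ = Sign.+
    ; nonParallel = inj₁ (fromℚ-mono-< {a₁ ℚ.* b₂} {a₂ ℚ.* b₁} det<) }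

  rescale : ∀ L κ n → κ ℚ.* (L ℚ.* n) ≡ L ℚ.* (κ ℚ.* n)
  rescale = solve-∀ ℚ-ring

  expand : ∀ L f h → (1ℚ ℚ.+ L) ℚ.* f ℚ.+ h ≡ f ℚ.+ (L ℚ.* f ℚ.+ h)
  expand = solve-∀ ℚ-ring

  -- Here `t` stands for `g A` or its negative. From ∣g A∣ ≤ L · norm A and κ · norm A ≤ f follows
  -- ∣κt∣ ≤ Lf, so `M f + κ t` is still at least f.
  dominates : ∀ {A t} → A ∈ steps X → ℚ.∣ t ∣ ℚ.≤ ℚ.∣ g A ∣ →
              0ℚ ℚ.< M ℚ.* linear p q A ℚ.+ κ ℚ.* t
  dominates {A} {t} A∈X t≤g = begin-strict
    0ℚ                                       <⟨ 0<κ ⟩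
    κ
      ≤⟨ coercive⇒positive {p} {q} {κ} {A} 0<κ (step≢O X A∈X) (coercive A∈X) ⟩
    f                                        ≡⟨ ℚ.+-identityʳ f ⟨
    f ℚ.+ 0ℚ                                 ≡⟨ cong (f ℚ.+_) (ℚ.+-inverseʳ (L ℚ.* f)) ⟨
    f ℚ.+ (L ℚ.* f ℚ.- L ℚ.* f)              ≤⟨ ℚ.+-monoʳ-≤ f (ℚ.+-monoʳ-≤ (L ℚ.* f) -Lf≤κt) ⟩
    f ℚ.+ (L ℚ.* f ℚ.+ κ ℚ.* t)              ≡⟨ expand L f (κ ℚ.* t) ⟨
    M ℚ.* f ℚ.+ κ ℚ.* t                      ∎
    where
    f = linear p q A
    ∣-q∣≤L : ℚ.∣ ℚ.- q ∣ ℚ.≤ L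
    ∣-q∣≤L = subst₂ ℚ._≤_ (trans (ℚ.+-identityˡ ℚ.∣ q ∣) (sym (ℚ.∣-p∣≡∣p∣ q))) refl
      (ℚ.+-monoˡ-≤ ℚ.∣ q ∣ (ℚ.0≤∣p∣ p))
    ∣p∣≤L : ℚ.∣ p ∣ ℚ.≤ L
    ∣p∣≤L = subst (ℚ._≤ L) (ℚ.+-identityʳ ℚ.∣ p ∣) (ℚ.+-monoʳ-≤ ℚ.∣ p ∣ (ℚ.0≤∣p∣ q))
    ∣κt∣≤Lf : ℚ.∣ κ ℚ.* t ∣ ℚ.≤ L ℚ.* f
    ∣κt∣≤Lf = begin
      ℚ.∣ κ ℚ.* t ∣                  ≡⟨ ℚ.∣p*q∣≡∣p∣*∣q∣ κ t ⟩
      ℚ.∣ κ ∣ ℚ.* ℚ.∣ t ∣            ≡⟨ cong (ℚ._* ℚ.∣ t ∣) (ℚ.0≤p⇒∣p∣≡p (ℚ.<⇒≤ 0<κ)) ⟩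
      κ ℚ.* ℚ.∣ t ∣                  ≤⟨ *-monoˡ-≤ (ℚ.<⇒≤ 0<κ) (ℚ.≤-trans t≤g (∣linear∣≤ A ∣-q∣≤L ∣p∣≤L)) ⟩
      κ ℚ.* (L ℚ.* norm A)           ≡⟨ rescale L κ (norm A) ⟩
      L ℚ.* (κ ℚ.* norm A)           ≤⟨ *-monoˡ-≤ 0≤L (coercive A∈X) ⟩
      L ℚ.* f                        ∎
    -Lf≤κt : ℚ.- (L ℚ.* f) ℚ.≤ κ ℚ.* t
    -Lf≤κt = ℚ.≤-trans (ℚ.neg-antimono-≤ ∣κt∣≤Lf) (-∣p∣≤p (κ ℚ.* t))

-- Finiteness of path sets for coercive step sets

interval : ℕ → List ℤ
interval N = map +_ (upTo (suc N)) ++ map (ℤ.-_ ∘ +_) (upTo (suc N))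

∈-interval : ∀ {N} i → ℤ.∣ i ∣ ℕ.≤ N → i ∈ₗ interval N
∈-interval     (+ n)    n≤N = ∈-++⁺ˡ (∈-map⁺ +_ (∈-upTo⁺ (s≤s n≤N)))
∈-interval {N} -[1+ n ] n≤N =
  ∈-++⁺ʳ (map +_ (upTo (suc N))) (∈-map⁺ (ℤ.-_ ∘ +_) (∈-upTo⁺ (s≤s n≤N)))

box : ℕ → List ℤ²
box N = cartesianProduct (interval N) (interval N)

∈-box : ∀ {N} A → size A ℕ.≤ N → A ∈ₗ box N
∈-box (x , y) ≤N = ∈-cartesianProduct⁺
  (∈-interval x (ℕ.m+n≤o⇒m≤o ℤ.∣ x ∣ ≤N)) (∈-interval y (ℕ.m+n≤o⇒n≤o ℤ.∣ x ∣ ≤N))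

-- The total size of the steps is at most f(A) / κ. It bounds each single step and, every step
-- having size at least 1, also the length; hence `N` serves both as box radius and as length bound.
Coercive⇒FPP : ∀ X C → Coercive X → FPP X C
Coercive⇒FPP X C coercive-X A _ =
  let N , bound = archimedean 0<κ (linear p q A)
  in wordsUpTo (box N) N , λ {w} ((w∈X* , _) , αw≡A) →
    let weight≤N = bound (subst (λ B → ⟦ + weight size w ⟧ ℚ.* κ ℚ.≤ linear p q B) αw≡A
                     (linear-α-≥ p q κ size (All.map size≤ w∈X*)))
    in ∈-wordsUpTo
      (All.map (λ {B} B≤ → ∈-box B (ℕ.≤-trans B≤ weight≤N)) (≤weight size w))
      (ℕ.≤-trans (length≤weight (All.map (λ B∈X → 1≤size (step≢O X B∈X)) w∈X*)) weight≤N)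
  where
  open Coercive coercive-X
  size≤ : ∀ {B} → B ∈ steps X → ⟦ + size B ⟧ ℚ.* κ ℚ.≤ linear p q B
  size≤ {B} B∈X = subst (ℚ._≤ linear p q B)
    (trans (ℚ.*-comm κ (norm B)) (cong (ℚ._* κ) (norm≡size B))) (coercive B∈X)

-- Counterexamples

full : Submonoid
full = record { carrier = λ _ → ⊤ ; O∈ = _ ; ⊕-closed = _ }

full-path : ∀ X {w} → w ∈ FreeMonoid X → w ∈ Paths X full
full-path X w∈X* = w∈X* , _

trivial : Submonoid
trivial = record { carrier = _≡ O ; O∈ = refl ; ⊕-closed = λ { refl refl → refl } }

-- The prefix of length 1 ends at the first step, which is not O.
trivial-paths : ∀ X {w} → w ∈ Paths X trivial → w ≡ []
trivial-paths X {[]}    _                      = refl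
trivial-paths X {A ∷ w} (A∈X ∷ _ , inside) = contradiction
  (trans (sym (⊕-identityʳ A)) (inside 1 (s≤s z≤n))) (step≢O X A∈X)

trivial-FPP : ∀ X → FPP X trivial
trivial-FPP X _ _ = [ [] ] , λ (w∈ , _) → here (trivial-paths X w∈)

east west north : ℤ²
east = 1ℤ , 0ℤ
west = -1ℤ , 0ℤ
north = 0ℤ , 1ℤ

horizontal : StepSet
horizontal = record
  { steps = _∈ₗ (east ∷ west ∷ [])
  ; O∉     = λ { (here ()) ; (there (here ())) ; (there (there ())) }
  }

horizontal-finite : FiniteStepSet horizontal
horizontal-finite = east ∷ west ∷ [] , id , id

horizontal-¬LC : ¬ LC horizontal
horizontal-¬LC lc = contradiction
  (LC⇒no-loops horizontal {east ∷ west ∷ []} lc (here refl ∷ there (here refl) ∷ []) refl) λ ()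

-- The rest of the horizontal axis is left out, so horizontal steps are forbidden at O but free at
-- positive height.
upperHalf : Submonoid
upperHalf = record
  { carrier  = λ A → A ≡ O ⊎ 0ℤ ℤ.< proj₂ A
  ; O∈       = inj₁ refl
  ; ⊕-closed = λ
    { {_} {B} (inj₁ refl) B∈ →
        subst (λ B → B ≡ O ⊎ 0ℤ ℤ.< proj₂ B) (sym (⊕-identityˡ B)) B∈
    ; {A} {_} (inj₂ 0<A)  (inj₁ refl) →
        inj₂ (subst (0ℤ ℤ.<_) (sym (ℤ.+-identityʳ (proj₂ A))) 0<A)
    ; (inj₂ 0<A) (inj₂ 0<B) → inj₂ (ℤ.+-mono-< 0<A 0<B)
    } }

threeSteps : StepSet
threeSteps = record
  { steps = _∈ₗ (east ∷ north ∷ west ∷ [])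
  ; O∉    = λ
    { (here ()) ; (there (here ())) ; (there (there (here ()))) ; (there (there (there ()))) }
  }

threeSteps-finite : FiniteStepSet threeSteps
threeSteps-finite = east ∷ north ∷ west ∷ [] , id , id

threeSteps-0≤y : ∀ {w} → w ∈ FreeMonoid threeSteps → 0ℤ ℤ.≤ proj₂ (α w)
threeSteps-0≤y []          = ℤ.≤-refl
threeSteps-0≤y (A∈ ∷ w∈)   = ℤ.+-mono-≤ (0≤y A∈) (threeSteps-0≤y w∈)
  where
  0≤y : ∀ {A} → A ∈ steps threeSteps → 0ℤ ℤ.≤ proj₂ A
  0≤y (here refl)                 = ℤ.≤-refl
  0≤y (there (here refl))         = ℤ.+≤+ z≤n
  0≤y (there (there (here refl))) = ℤ.≤-refl

north∷-0<y : ∀ {w} → w ∈ FreeMonoid threeSteps → 0ℤ ℤ.< proj₂ (α (north ∷ w))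
north∷-0<y w∈ = ℤ.+-mono-<-≤ (ℤ.+<+ (s≤s z≤n)) (threeSteps-0≤y w∈)

-- A first step east or west lands on the excluded part of the axis, and after a first step north
-- the height never returns to 0.
threeSteps-¬IPP : ¬ IPP threeSteps upperHalf
threeSteps-¬IPP = no-loops⇒¬IPP threeSteps upperHalf no-loop
  where
  no-loop : ∀ {w} → w ∈ PathsTo threeSteps upperHalf O → w ≡ []
  no-loop {[]}    _ = refl
  no-loop {A ∷ w} ((here refl ∷ _ , inside) , _) with inside 1 (s≤s z≤n)
  ... | inj₂ (ℤ.+<+ ())
  no-loop {A ∷ w} ((there (here refl) ∷ w∈ , _) , αw≡O) =
    contradiction (subst (0ℤ ℤ.<_) (cong proj₂ αw≡O) (north∷-0<y w∈)) (ℤ.<-irrefl {0ℤ} refl)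
  no-loop {A ∷ w} ((there (there (here refl)) ∷ _ , inside) , _) with inside 1 (s≤s z≤n)
  ... | inj₂ (ℤ.+<+ ())

threeSteps-¬BPP : ¬ BPP threeSteps upperHalf
threeSteps-¬BPP = unbounded⇒¬BPP threeSteps upperHalf north λ n →
  north ∷ shuttle n ,
  ((there (here refl) ∷ shuttle∈ n , inside n) , cong (north ⊕_) (α-shuttle n)) ,
  ℕ.m≤n⇒m≤1+n (long n)
  where
  shuttle : ℕ → Word
  shuttle zero    = []
  shuttle (suc n) = east ∷ west ∷ shuttle n

  shuttle∈ : ∀ n → shuttle n ∈ FreeMonoid threeSteps
  shuttle∈ zero    = []
  shuttle∈ (suc n) = here refl ∷ there (there (here refl)) ∷ shuttle∈ n

  α-shuttle : ∀ n → α (shuttle n) ≡ O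
  α-shuttle zero    = refl
  α-shuttle (suc n) = cong (λ A → east ⊕ (west ⊕ A)) (α-shuttle n)

  inside : ∀ n m → m ℕ.≤ length (north ∷ shuttle n) → α (take m (north ∷ shuttle n)) ∈ carrier upperHalf
  inside n zero    _ = inj₁ refl
  inside n (suc m) _ = inj₂ (north∷-0<y (All.take⁺ m (shuttle∈ n)))

  long : ∀ n → n ℕ.≤ length (shuttle n)
  long zero    = z≤n
  long (suc n) = s≤s (ℕ.m≤n⇒m≤1+n (long n))

column : StepSet
column = record { steps = λ A → proj₁ A ≡ 1ℤ ; O∉ = λ () }

column-SLC : SLC column
column-SLC = rationalLine 1ℚ 0ℚ ½ (inj₁ ℚ.1≢0) , Sign.+ ,
  (λ { {_ , y} refl → fromℚ-mono-< {½} {linear 1ℚ 0ℚ (1ℤ , y)}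
    (subst (½ ℚ.<_) (sym (cong (1ℚ ℚ.+_) (ℚ.*-zeroˡ ⟦ y ⟧))) (*<* (ℤ.+<+ (s≤s (s≤s z≤n))))) }) ,
  fromℚ-mono-< {0ℚ} {½} (*<* (ℤ.+<+ (s≤s z≤n)))

column-¬FPP : ¬ FPP column full
-- The words used all have length 2, so their total size has to tell them apart.
column-¬FPP fpp = unbounded⇒¬finite (weight size)
  (λ n → bounce n , bounce∈ n , ℕ.m≤n⇒m≤1+n (ℕ.m≤m+n n _))
  (fpp (α (bounce 0)) (bounce 0 , bounce∈ 0))
  where
  bounce : ℕ → Word
  bounce n = (1ℤ , + n) ∷ (1ℤ , ℤ.- + n) ∷ []

  bounce∈ : ∀ n → bounce n ∈ PathsTo column full (+ 2 , 0ℤ)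
  bounce∈ n = full-path column (refl ∷ refl ∷ []) , cong (+ 2 ,_)
    (trans (cong (ℤ._+_ (+ n)) (ℤ.+-identityʳ (ℤ.- + n))) (ℤ.+-inverseʳ (+ n)))

-- Fibonacci numbers and the golden slope

fib : ℕ → ℕ
fib 0             = 1
fib 1             = 1
fib (suc (suc n)) = fib (suc n) ℕ.+ fib n

1≤fib : ∀ n → 1 ℕ.≤ fib n
1≤fib 0             = ℕ.≤-refl
1≤fib 1             = ℕ.≤-refl
1≤fib (suc (suc n)) = ℕ.≤-trans (1≤fib (suc n)) (ℕ.m≤m+n _ _)

fib≤fib-suc : ∀ n → fib n ℕ.≤ fib (suc n)
fib≤fib-suc zero    = ℕ.≤-refl
fib≤fib-suc (suc n) = ℕ.m≤m+n _ _

n<fib-suc : ∀ n → n ℕ.< fib (suc n)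
n<fib-suc zero    = ℕ.≤-refl
n<fib-suc (suc n) = ℕ.≤-trans (s≤s (n<fib-suc n))
  (ℕ.≤-trans (ℕ.≤-reflexive (ℕ.+-comm 1 (fib (suc n)))) (ℕ.+-monoʳ-≤ (fib (suc n)) (1≤fib n)))

-- Each term is at most twice its predecessor. The factor is independent of `m`, which gives
-- `golden-above` a fixed margin.
fib≤2^*fib : ∀ k m → fib (k ℕ.+ m) ℕ.≤ 2 ℕ.^ k ℕ.* fib m
fib≤2^*fib zero    m = ℕ.≤-reflexive (sym (ℕ.*-identityˡ (fib m)))
fib≤2^*fib (suc k) m = begin
  fib (suc (k ℕ.+ m))                 ≤⟨ doubling (k ℕ.+ m) ⟩
  2 ℕ.* fib (k ℕ.+ m)                 ≤⟨ ℕ.*-monoʳ-≤ 2 (fib≤2^*fib k m) ⟩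
  2 ℕ.* (2 ℕ.^ k ℕ.* fib m)           ≡⟨ ℕ.*-assoc 2 (2 ℕ.^ k) (fib m) ⟨
  2 ℕ.^ suc k ℕ.* fib m               ∎
  where
  open ℕ.≤-Reasoning
  doubling : ∀ n → fib (suc n) ℕ.≤ 2 ℕ.* fib n
  doubling zero    = s≤s z≤n
  doubling (suc n) = ℕ.+-monoʳ-≤ (fib (suc n))
    (ℕ.≤-trans (fib≤fib-suc n) (ℕ.≤-reflexive (sym (ℕ.+-identityʳ (fib (suc n))))))

-- Up to sign, this is a Fibonacci number again (d'Ocagne's identity).
cross : ℕ → ℕ → ℤ
cross n d = + fib n ℤ.* + fib (suc (n ℕ.+ d)) ℤ.- + fib (n ℕ.+ d) ℤ.* + fib (suc n)

-- By the Fibonacci recurrence, passing from `n` to `n + 1` only flips the sign of `cross`. The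
-- bound is crude, chosen as the denominator to be cancelled in `τ-close`.
∣cross∣≤ : ∀ n d → ℤ.∣ cross n d ∣ ℕ.≤ fib (suc (n ℕ.+ d))
∣cross∣≤ zero d = begin
  ℤ.∣ cross 0 d ∣
    ≡⟨ cong₂ (λ i j → ℤ.∣ i ℤ.- j ∣) (ℤ.*-identityˡ (+ fib (suc d))) (ℤ.*-identityʳ (+ fib d)) ⟩
  ℤ.∣ + fib (suc d) ℤ.- + fib d ∣
    ≡⟨ cong ℤ.∣_∣ (trans (ℤ.m-n≡m⊖n (fib (suc d)) (fib d)) (ℤ.⊖-≥ (fib≤fib-suc d))) ⟩
  fib (suc d) ℕ.∸ fib d                       ≤⟨ ℕ.m∸n≤m (fib (suc d)) (fib d) ⟩
  fib (suc d)                                 ∎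
  where open ℕ.≤-Reasoning
∣cross∣≤ (suc n) d = ℕ.≤-trans
  (ℕ.≤-reflexive (trans
    (cong ℤ.∣_∣ (alternate (+ fib n) (+ fib (suc n)) (+ fib (n ℕ.+ d)) (+ fib (suc (n ℕ.+ d)))))
    (ℤ.∣-i∣≡∣i∣ (cross n d))))
  (ℕ.≤-trans (∣cross∣≤ n d) (fib≤fib-suc (suc (n ℕ.+ d))))
  where
  alternate : ∀ a a′ b b′ → a′ ℤ.* (b′ ℤ.+ b) ℤ.- b′ ℤ.* (a′ ℤ.+ a) ≡ ℤ.- (a ℤ.* b′ ℤ.- b ℤ.* a′)
  alternate = ℤ-Ring.solve-∀

F : ℕ → ℚ
F n = ⟦ + fib n ⟧

0<F : ∀ n → 0ℚ ℚ.< F n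
0<F n = ℚ.<-≤-trans 0<1ℚ (1≤⟦+⟧ (1≤fib n))

ratio : ∀ n → ∃[ r ] F (suc n) ℚ.* r ≡ F n
ratio n = let r , _ , eq = divide (F (suc n)) (F n) (0<F (suc n)) (0<F n) in r , eq

-- The quotients fib n / fib (n + 1), converging to (√5 - 1) / 2.
τ : ℕ → ℚ
τ n = proj₁ (ratio n)

F*τ : ∀ n → F (suc n) ℚ.* τ n ≡ F n
F*τ n = proj₂ (ratio n)

-- The difference of the quotients is `cross n d` over the product of their denominators, and the
-- bound on `cross` cancels the later one.
τ-close : ∀ n d → F (suc n) ℚ.* ℚ.∣ τ n ℚ.- τ (n ℕ.+ d) ∣ ℚ.≤ 1ℚ
τ-close n d = *-cancelˡ-≤ (0<F (suc m)) (begin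
  F (suc m) ℚ.* (F (suc n) ℚ.* ℚ.∣ τ n ℚ.- τ m ∣)
    ≡⟨ cong₂ (λ p q → p ℚ.* (q ℚ.* ℚ.∣ τ n ℚ.- τ m ∣)) (∣F∣ (suc m)) (∣F∣ (suc n)) ⟨
  ℚ.∣ F (suc m) ∣ ℚ.* (ℚ.∣ F (suc n) ∣ ℚ.* ℚ.∣ τ n ℚ.- τ m ∣)
    ≡⟨ cong (ℚ.∣ F (suc m) ∣ ℚ.*_) (ℚ.∣p*q∣≡∣p∣*∣q∣ (F (suc n)) (τ n ℚ.- τ m)) ⟨
  ℚ.∣ F (suc m) ∣ ℚ.* ℚ.∣ F (suc n) ℚ.* (τ n ℚ.- τ m) ∣
    ≡⟨ ℚ.∣p*q∣≡∣p∣*∣q∣ (F (suc m)) (F (suc n) ℚ.* (τ n ℚ.- τ m)) ⟨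
  ℚ.∣ F (suc m) ℚ.* (F (suc n) ℚ.* (τ n ℚ.- τ m)) ∣
    ≡⟨ cong ℚ.∣_∣ cross-eq ⟩
  ℚ.∣ ⟦ cross n d ⟧ ∣
    ≡⟨ ∣⟦⟧∣ (cross n d) ⟩
  ⟦ + ℤ.∣ cross n d ∣ ⟧
    ≤⟨ ⟦⟧-mono-≤ {+ ℤ.∣ cross n d ∣} {+ fib (suc m)} (ℤ.+≤+ (∣cross∣≤ n d)) ⟩
  F (suc m)
    ≡⟨ ℚ.*-identityʳ (F (suc m)) ⟨
  F (suc m) ℚ.* 1ℚ ∎)
  where
  open ℚ.≤-Reasoning
  m = n ℕ.+ d

  ∣F∣ : ∀ k → ℚ.∣ F k ∣ ≡ F k
  ∣F∣ k = ℚ.0≤p⇒∣p∣≡p (ℚ.<⇒≤ (0<F k))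

  distribute : ∀ P Q s t → P ℚ.* (Q ℚ.* (s ℚ.- t)) ≡ (Q ℚ.* s) ℚ.* P ℚ.- (P ℚ.* t) ℚ.* Q
  distribute = solve-∀ ℚ-ring

  cross-eq : F (suc m) ℚ.* (F (suc n) ℚ.* (τ n ℚ.- τ m)) ≡ ⟦ cross n d ⟧
  cross-eq = begin-equality
    F (suc m) ℚ.* (F (suc n) ℚ.* (τ n ℚ.- τ m))
      ≡⟨ distribute (F (suc m)) (F (suc n)) (τ n) (τ m) ⟩
    (F (suc n) ℚ.* τ n) ℚ.* F (suc m) ℚ.- (F (suc m) ℚ.* τ m) ℚ.* F (suc n)
      ≡⟨ cong₂ (λ p q → p ℚ.* F (suc m) ℚ.- q ℚ.* F (suc n)) (F*τ n) (F*τ m) ⟩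
    F n ℚ.* F (suc m) ℚ.- F m ℚ.* F (suc n)
      ≡⟨ cong₂ ℚ._-_ (⟦⟧-* (+ fib n) (+ fib (suc m))) (⟦⟧-* (+ fib m) (+ fib (suc n))) ⟨
    ⟦ + fib n ℤ.* + fib (suc m) ⟧ ℚ.- ⟦ + fib m ℤ.* + fib (suc n) ⟧
      ≡⟨ cong (⟦ + fib n ℤ.* + fib (suc m) ⟧ ℚ.+_) (⟦⟧-neg (+ fib m ℤ.* + fib (suc n))) ⟨
    ⟦ + fib n ℤ.* + fib (suc m) ⟧ ℚ.+ ⟦ ℤ.- (+ fib m ℤ.* + fib (suc n)) ⟧
      ≡⟨ ⟦⟧-+ (+ fib n ℤ.* + fib (suc m)) (ℤ.- (+ fib m ℤ.* + fib (suc n))) ⟨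
    ⟦ cross n d ⟧ ∎

τ-cauchy : Cauchy τ
τ-cauchy ε 0<ε = N , close
  where
  N = proj₁ (archimedean 0<ε 1ℚ)

  ordered : ∀ m n → N ℕ.≤ m → m ℕ.≤ n → ℚ.∣ τ m ℚ.- τ n ∣ ℚ.< ε
  -- A difference of at least `ε` would give fib (1 + m) · ε ≤ 1 and so fib (1 + m) ≤ N, against fib
  -- (1 + m) > m ≥ N.
  ordered m n N≤m m≤n = ℚ.≰⇒> λ ε≤ → ℕ.<⇒≱ (ℕ.≤-<-trans N≤m (n<fib-suc m))
    (proj₂ (archimedean 0<ε 1ℚ) {fib (suc m)} (ℚ.≤-trans (*-monoˡ-≤ (ℚ.<⇒≤ (0<F (suc m))) ε≤)
      (subst (λ k → F (suc m) ℚ.* ℚ.∣ τ m ℚ.- τ k ∣ ℚ.≤ 1ℚ) (ℕ.m+[n∸m]≡n m≤n) (τ-close m (n ℕ.∸ m)))))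

  swap : ∀ p q → ℚ.∣ p ℚ.- q ∣ ≡ ℚ.∣ q ℚ.- p ∣
  swap p q = trans (cong ℚ.∣_∣ (negate p q)) (ℚ.∣-p∣≡∣p∣ (q ℚ.- p))
    where
    negate : ∀ p q → p ℚ.- q ≡ ℚ.- (q ℚ.- p)
    negate = solve-∀ ℚ-ring

  close : ∀ m n → N ℕ.≤ m → N ℕ.≤ n → ℚ.∣ τ m ℚ.- τ n ∣ ℚ.< ε
  close m n N≤m N≤n = Sum.[ (λ m≤n → ordered m n N≤m m≤n)
                          , (λ n≤m → subst (ℚ._< ε) (swap (τ n) (τ m)) (ordered n m N≤n n≤m)) ]′
                          (ℕ.≤-total m n)

-- In the limit of x + τ n y, golden k takes the value τᵏ with τ = (√5 − 1) / 2;
-- height n is x + τ n y with its denominator fib (1 + n) cleared.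
golden : ℕ → ℤ²
golden 0             = 1ℤ , 0ℤ
golden 1             = 0ℤ , 1ℤ
golden (suc (suc k)) =
  proj₁ (golden k) ℤ.- proj₁ (golden (suc k)) , proj₂ (golden k) ℤ.- proj₂ (golden (suc k))

golden-split : ∀ k → golden (suc k) ⊕ golden (suc (suc k)) ≡ golden k
golden-split k = cong₂ _,_ (cancel (proj₁ (golden (suc k))) (proj₁ (golden k)))
                           (cancel (proj₂ (golden (suc k))) (proj₂ (golden k)))
  where
  cancel : ∀ i j → i ℤ.+ (j ℤ.- i) ≡ j
  cancel = ℤ-Ring.solve-∀

height : ℕ → ℤ² → ℤ
height n (x , y) = x ℤ.* + fib (suc n) ℤ.+ y ℤ.* + fib n

-- Height is additive, so at a fixed level the vectors run through the Fibonacci recurrence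
-- backwards. Writing the level as `k + m` avoids truncated subtraction.
height-golden : ∀ k m → height (k ℕ.+ m) (golden k) ≡ + fib (suc m)
height-golden 0 m = trans (ℤ.+-identityʳ _) (ℤ.*-identityˡ (+ fib (suc m)))
height-golden 1 m = trans (ℤ.+-identityˡ _) (ℤ.*-identityˡ (+ fib (suc m)))
height-golden (suc (suc k)) m = begin
  height (2 ℕ.+ k ℕ.+ m) (golden (2 ℕ.+ k))
    ≡⟨ difference (proj₁ (golden k)) (proj₁ (golden (suc k))) (proj₂ (golden k)) (proj₂ (golden (suc k)))
         (+ fib (3 ℕ.+ k ℕ.+ m)) (+ fib (2 ℕ.+ k ℕ.+ m)) ⟩
  height (2 ℕ.+ k ℕ.+ m) (golden k) ℤ.- height (2 ℕ.+ k ℕ.+ m) (golden (suc k))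
    ≡⟨ cong₂ (λ i j → height i (golden k) ℤ.- height j (golden (suc k)))
         (sym (trans (ℕ.+-suc k (suc m)) (cong suc (ℕ.+-suc k m)))) (cong suc (sym (ℕ.+-suc k m))) ⟩
  height (k ℕ.+ (2 ℕ.+ m)) (golden k) ℤ.- height (suc k ℕ.+ (1 ℕ.+ m)) (golden (suc k))
    ≡⟨ cong₂ ℤ._-_ (height-golden k (2 ℕ.+ m)) (height-golden (suc k) (1 ℕ.+ m)) ⟩
  + fib (2 ℕ.+ m) ℤ.+ + fib (suc m) ℤ.- + fib (2 ℕ.+ m)
    ≡⟨ cancel (+ fib (2 ℕ.+ m)) (+ fib (suc m)) ⟩
  + fib (suc m) ∎
  where
  open ≡-Reasoning
  difference : ∀ x x′ y y′ a b → (x ℤ.- x′) ℤ.* a ℤ.+ (y ℤ.- y′) ℤ.* b ≡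
    (x ℤ.* a ℤ.+ y ℤ.* b) ℤ.- (x′ ℤ.* a ℤ.+ y′ ℤ.* b)
  difference = ℤ-Ring.solve-∀
  cancel : ∀ i j → i ℤ.+ j ℤ.- i ≡ j
  cancel = ℤ-Ring.solve-∀

goldenSteps : StepSet
goldenSteps = record
  { steps = λ A → ∃[ k ] A ≡ golden k
  -- At level `k` the height of `golden k` is `fib 1`, that is 1, while O has height 0.
  ; O∉    = λ (k , O≡) → contradiction
      (trans (cong (height (k ℕ.+ 0)) O≡) (height-golden k 0)) λ () }

-- Splitting the last letter by `golden-split` lengthens a word by one and keeps its endpoint.
golden-¬BPP : ¬ BPP goldenSteps full
golden-¬BPP = unbounded⇒¬BPP goldenSteps full (golden 0) λ n →
  split n 0 , (full-path goldenSteps (split∈ n 0) , α-split n 0) , long n 0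
  where
  split : ℕ → ℕ → Word
  split zero    k = [ golden k ]
  split (suc n) k = golden (suc k) ∷ split n (suc (suc k))

  split∈ : ∀ n k → split n k ∈ FreeMonoid goldenSteps
  split∈ zero    k = (k , refl) ∷ []
  split∈ (suc n) k = (suc k , refl) ∷ split∈ n (suc (suc k))

  α-split : ∀ n k → α (split n k) ≡ golden k
  α-split zero    k = ⊕-identityʳ (golden k)
  α-split (suc n) k = trans (cong (golden (suc k) ⊕_) (α-split n (suc (suc k)))) (golden-split k)

  long : ∀ n k → n ℕ.≤ length (split n k)
  long zero    _ = z≤n
  long (suc n) k = s≤s (long n (suc (suc k)))

linear-τ : ∀ n A → F (suc n) ℚ.* linear 1ℚ (τ n) A ≡ ⟦ height n A ⟧
linear-τ n (x , y) = begin
  F (suc n) ℚ.* (1ℚ ℚ.* ⟦ x ⟧ ℚ.+ τ n ℚ.* ⟦ y ⟧)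
    ≡⟨ distribute (F (suc n)) (τ n) ⟦ x ⟧ ⟦ y ⟧ ⟩
  ⟦ x ⟧ ℚ.* F (suc n) ℚ.+ ⟦ y ⟧ ℚ.* (F (suc n) ℚ.* τ n)
    ≡⟨ cong (λ p → ⟦ x ⟧ ℚ.* F (suc n) ℚ.+ ⟦ y ⟧ ℚ.* p) (F*τ n) ⟩
  ⟦ x ⟧ ℚ.* F (suc n) ℚ.+ ⟦ y ⟧ ℚ.* F n
    ≡⟨ cong₂ ℚ._+_ (⟦⟧-* x (+ fib (suc n))) (⟦⟧-* y (+ fib n)) ⟨
  ⟦ x ℤ.* + fib (suc n) ⟧ ℚ.+ ⟦ y ℤ.* + fib n ⟧
    ≡⟨ ⟦⟧-+ (x ℤ.* + fib (suc n)) (y ℤ.* + fib n) ⟨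
  ⟦ height n (x , y) ⟧ ∎
  where
  open ≡-Reasoning
  distribute : ∀ P t x y → P ℚ.* (1ℚ ℚ.* x ℚ.+ t ℚ.* y) ≡ x ℚ.* P ℚ.+ y ℚ.* (P ℚ.* t)
  distribute = solve-∀ ℚ-ring

goldenLine : Line
goldenLine = lineThroughO (fromℚ 1ℚ) (mkℝ τ τ-cauchy) (inj₁ (fromℚ-# ℚ.1≢0))

-- At index `k + m` the form has the value fib (1 + m) / fib (1 + k + m), which is at least 1 / 2ᵏ;
-- this is the margin `ε` that the order on the reals requires.
golden-above : ∀ k → ι (golden k) ∈ halfPlane goldenLine Sign.+
golden-above k = ε , 0<ε , k , λ n k≤n →
  subst (λ n → 0ℚ ℚ.+ ε ℚ.≤ linear 1ℚ (τ n) (golden k)) (ℕ.m+[n∸m]≡n k≤n) (above (n ℕ.∸ k))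
  where
  open ℚ.≤-Reasoning
  P = ⟦ + (2 ℕ.^ k) ⟧
  inverse = divide P 1ℚ (ℚ.<-≤-trans 0<1ℚ (1≤⟦+⟧ (ℕ.m^n>0 2 k))) 0<1ℚ
  ε     = proj₁ inverse
  0<ε   = proj₁ (proj₂ inverse)
  P*ε≡1 = proj₂ (proj₂ inverse)

  rotate : ∀ p q r → p ℚ.* q ℚ.* r ≡ q ℚ.* (p ℚ.* r)
  rotate = solve-∀ ℚ-ring

  above : ∀ m → 0ℚ ℚ.+ ε ℚ.≤ linear 1ℚ (τ (k ℕ.+ m)) (golden k)
  above m = *-cancelˡ-≤ (0<F (suc (k ℕ.+ m))) (begin
    F (suc (k ℕ.+ m)) ℚ.* (0ℚ ℚ.+ ε)
      ≡⟨ cong (F (suc (k ℕ.+ m)) ℚ.*_) (ℚ.+-identityˡ ε) ⟩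
    F (suc (k ℕ.+ m)) ℚ.* ε
      ≤⟨ *-monoʳ-≤ (ℚ.<⇒≤ 0<ε) (⟦⟧-mono-≤ {+ fib (suc (k ℕ.+ m))}
           {+ (2 ℕ.^ k ℕ.* fib (suc m))} (ℤ.+≤+ fib≤)) ⟩
    ⟦ + (2 ℕ.^ k ℕ.* fib (suc m)) ⟧ ℚ.* ε
      ≡⟨ cong (λ i → ⟦ i ⟧ ℚ.* ε) (ℤ.pos-* (2 ℕ.^ k) (fib (suc m))) ⟩
    ⟦ + (2 ℕ.^ k) ℤ.* + fib (suc m) ⟧ ℚ.* ε
      ≡⟨ cong (ℚ._* ε) (⟦⟧-* (+ (2 ℕ.^ k)) (+ fib (suc m))) ⟩
    P ℚ.* F (suc m) ℚ.* ε
      ≡⟨ rotate P (F (suc m)) ε ⟩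
    F (suc m) ℚ.* (P ℚ.* ε)
      ≡⟨ cong (F (suc m) ℚ.*_) P*ε≡1 ⟩
    F (suc m) ℚ.* 1ℚ
      ≡⟨ ℚ.*-identityʳ (F (suc m)) ⟩
    F (suc m)
      ≡⟨ cong ⟦_⟧ (height-golden k m) ⟨
    ⟦ height (k ℕ.+ m) (golden k) ⟧
      ≡⟨ linear-τ (k ℕ.+ m) (golden k) ⟨
    F (suc (k ℕ.+ m)) ℚ.* linear 1ℚ (τ (k ℕ.+ m)) (golden k) ∎)
    where
    fib≤ : fib (suc (k ℕ.+ m)) ℕ.≤ 2 ℕ.^ k ℕ.* fib (suc m)
    fib≤ = subst (λ j → fib j ℕ.≤ 2 ℕ.^ k ℕ.* fib (suc m)) (ℕ.+-suc k m) (fib≤2^*fib k (suc m))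

golden-LC : LC goldenSteps
golden-LC = goldenLine , Sign.+ ,
  O∈lineThroughO (fromℚ 1ℚ) (mkℝ τ τ-cauchy) (inj₁ (fromℚ-# ℚ.1≢0)) ,
  λ { (k , refl) → golden-above k }

theorem3p6 : (∀ (X : StepSet) (C : Submonoid) →
    (CC X → SLC X)
    × (SLC X → LC X)
    × (FPP X C → BPP X C)
    × (BPP X C → ¬ IPP X C)
    × (CC X → FPP X C)
    × (SLC X → BPP X C)
    × (LC X → ¬ IPP X C))
    ×
    ((∀ (X : StepSet) (C : Submonoid) → FiniteStepSet X →
    (SLC X → CC X)
    × (LC X → SLC X)
    × (BPP X C → FPP X C))
    × (∃₂ λ (X : StepSet) (C : Submonoid) → FiniteStepSet X × ¬ IPP X C × ¬ BPP X C)
    × (∃₂ λ (X : StepSet) (C : Submonoid) → FiniteStepSet X × FPP X C × ¬ CC X)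
    × (∃₂ λ (X : StepSet) (C : Submonoid) → FiniteStepSet X × BPP X C × ¬ SLC X)
    × (∃₂ λ (X : StepSet) (C : Submonoid) → FiniteStepSet X × ¬ IPP X C × ¬ LC X))
    ×
    ((∃₂ λ (X : StepSet) (C : Submonoid) → SLC X × ¬ CC X)
    × (∃₂ λ (X : StepSet) (C : Submonoid) → LC X × ¬ SLC X)
    × (∃₂ λ (X : StepSet) (C : Submonoid) → BPP X C × ¬ FPP X C)
    × (∃₂ λ (X : StepSet) (C : Submonoid) → ¬ IPP X C × ¬ BPP X C)
    × (∃₂ λ (X : StepSet) (C : Submonoid) → FPP X C × ¬ CC X)
    × (∃₂ λ (X : StepSet) (C : Submonoid) → BPP X C × ¬ SLC X)
    × (∃₂ λ (X : StepSet) (C : Submonoid) → ¬ IPP X C × ¬ LC X))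
theorem3p6 =
  (λ X C →
      Coercive⇒SLC X ∘ CC⇒Coercive X
    , SLC⇒LC X
    , FPP⇒BPP X C
    , BPP⇒¬IPP X C
    , Coercive⇒FPP X C ∘ CC⇒Coercive X
    , SLC⇒BPP X C
    , LC⇒¬IPP X C)
  , ((λ X C finite →
        -- For finite `X` the LC already yields coercivity, from which CC and SLC are recovered.
        Coercive⇒CC X ∘ finite∧LC⇒Coercive X finite ∘ SLC⇒LC X
      , Coercive⇒SLC X ∘ finite∧LC⇒Coercive X finite
      , finite∧BPP⇒FPP X C finite)
    , (threeSteps , upperHalf , threeSteps-finite , ¬IPP∧¬BPP)
    , (horizontal , trivial , horizontal-finite , FPP∧¬CC)
    , (horizontal , trivial , horizontal-finite , BPP∧¬SLC)
    , (horizontal , trivial , horizontal-finite , ¬IPP∧¬LC))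
  -- CC and SLC are refuted here through the path properties they would force, the FPP and the BPP
  -- respectively.
  , ( (column , full , column-SLC , column-¬FPP ∘ Coercive⇒FPP column full ∘ CC⇒Coercive column)
    , (goldenSteps , full , golden-LC , golden-¬BPP ∘ SLC⇒BPP goldenSteps full)
    , (column , full , SLC⇒BPP column full column-SLC , column-¬FPP)
    , (threeSteps , upperHalf , ¬IPP∧¬BPP)
    , (horizontal , trivial , FPP∧¬CC)
    , (horizontal , trivial , BPP∧¬SLC)
    , (horizontal , trivial , ¬IPP∧¬LC))
  where
  ¬IPP∧¬BPP : ¬ IPP threeSteps upperHalf × ¬ BPP threeSteps upperHalf
  ¬IPP∧¬BPP = threeSteps-¬IPP , threeSteps-¬BPP

  horizontal-BPP : BPP horizontal trivial
  horizontal-BPP = FPP⇒BPP horizontal trivial (trivial-FPP horizontal)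

  BPP∧¬SLC : BPP horizontal trivial × ¬ SLC horizontal
  BPP∧¬SLC = horizontal-BPP , horizontal-¬LC ∘ SLC⇒LC horizontal

  FPP∧¬CC : FPP horizontal trivial × ¬ CC horizontal
  FPP∧¬CC = trivial-FPP horizontal
          , proj₂ BPP∧¬SLC ∘ Coercive⇒SLC horizontal ∘ CC⇒Coercive horizontal

  ¬IPP∧¬LC : ¬ IPP horizontal trivial × ¬ LC horizontal
  ¬IPP∧¬LC = BPP⇒¬IPP horizontal trivial horizontal-BPP , horizontal-¬LC
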